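{- For every $n\ge1$, the number $M'\setminus N'(n,2)$ of 2-ball strict multiplex prime juggling patterns of period $n$ satisfies $$M'\setminus N'(n,2)=\sum_{t\ge1}\Big(\sum_{m=1}^{n-1}t\cdot c_t(m)\Big)+1.$$
   Context: A 2-ball multiplex state is a sequence $\alpha=(\alpha_1,\alpha_2,\dots)$ with $\alpha_i\in\{0,1,2\}$, finitely many nonzero, $\sum_i\alpha_i=2$. There is a transition $\alpha\to\beta$ iff $\alpha_{i+1}\le\beta_i$ for all $i\ge1$. A 2-ball multiplex prime juggling pattern of period $n$ is a directed cycle of length $n$ in this state graph (closed walk of length $n$ visiting $n$ distinct states), counted up to cyclic rotation. It is normal if all its states have entries in $\{0,1\}$, and strict multiplex otherwise. For integers $t,m\ge1$, $$c_t(m)=\sum_{\substack{p_1>\cdots>p_t\ge1\\ p_1+\cdots+p_t=m}}\frac{1}{t(t+1)}\prod_{i=1}^t\Big(\frac{i+1}{i}\Big)^{p_i}.$$ -}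

module Defs where

open import Data.Nat as ℕ using (ℕ; zero; suc; _+_; _∸_; _≤_; _<_; _≤?_)
open import Data.Integer using (+_)
open import Data.Rational as ℚ using (ℚ; 0ℚ; 1ℚ; _/_)
open import Data.List as List using (List; []; _∷_; _++_; map; foldr; upTo; length)
open import Data.Nat.ListAction using (sum)
open import Data.List.Relation.Unary.All using (All)
open import Data.List.Relation.Unary.Any using (Any)
open import Data.List.Relation.Unary.AllPairs using (AllPairs)
open import Data.Product using (Σ; ∃; _×_; _,_)
open import Relation.Binary.PropositionalEquality using (_≡_)
open import Relation.Nullary using (¬_; yes; no)

-- 2-ball multiplex states.
-- A state α = (α₁, α₂, …) is represented by a function  st : ℕ → ℕ
-- with  st i = α_{i+1}  (0-based indexing), entries in {0,1,2},
-- finite support, and total sum 2.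

record State : Set where
  field
    α       : ℕ → ℕ
    entries : ∀ i → α i ≤ 2
    support : Σ ℕ λ N → (∀ i → N ≤ i → α i ≡ 0)
                      × (sum (map α (upTo N)) ≡ 2)
open State public

_≈ₛ_ : State → State → Set
s ≈ₛ t = ∀ i → α s i ≡ α t i

_⇒_ : State → State → Set
s ⇒ t = ∀ i → α s (suc i) ≤ α t i

-- 2-ball multiplex prime juggling patterns of period n:
-- directed cycles s₀ → s₁ → ⋯ → s_{n-1} → s₀ of n distinct states,
-- written as an n-periodic sequence of states.

record Pattern (n : ℕ) : Set where
  field
    state    : ℕ → State
    periodic : ∀ j → state (j + n) ≈ₛ state j
    step     : ∀ j → state j ⇒ state (suc j)
    distinct : ∀ i j → i < n → j < n → state i ≈ₛ state j → i ≡ j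
open Pattern public

RotEq : ∀ {n} → Pattern n → Pattern n → Set
RotEq {n} p q = Σ ℕ λ k → k < n × (∀ j → state p j ≈ₛ state q (j + k))

Strict : ∀ {n} → Pattern n → Set
Strict {n} p = Σ ℕ λ j → j < n × Σ ℕ λ i → α (state p j) i ≡ 2

StrictCount : ℕ → ℕ → Set
StrictCount n k =
  Σ (List (Pattern n)) λ L →
      All Strict L
    × AllPairs (λ p q → ¬ RotEq p q) L
    × (∀ (p : Pattern n) → Strict p → Any (RotEq p) L)
    × length L ≡ k

distinctParts : ℕ → ℕ → List (List ℕ)
distinctParts zero    zero    = [] ∷ []
distinctParts zero    (suc m) = []
distinctParts (suc b) m with suc b ≤? m
... | yes _ = distinctParts b m ++ map (suc b ∷_) (distinctParts b (m ∸ suc b))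
... | no  _ = distinctParts b m

_^ℚ_ : ℚ → ℕ → ℚ
q ^ℚ zero  = 1ℚ
q ^ℚ suc k = q ℚ.* (q ^ℚ k)

sumℚ : List ℚ → ℚ
sumℚ = foldr ℚ._+_ 0ℚ

-- ∏_{i ≥ i₀} ((i+1)/i)^{p_i}   for p = (p_{i₀}, p_{i₀+1}, …),  i₀ = suc k
weightFrom : ℕ → List ℕ → ℚ
weightFrom k []       = 1ℚ
weightFrom k (p ∷ ps) = (((+ (suc (suc k))) / suc k) ^ℚ p) ℚ.* weightFrom (suc k) ps

-- c_t(m) = Σ_{p₁>⋯>p_t≥1, Σp=m} 1/(t(t+1)) ∏_{i=1}^t ((i+1)/i)^{p_i}
-- (c is only used for t ≥ 1; we set c 0 m = 0, which is never used)
c : ℕ → ℕ → ℚ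
c zero    m = 0ℚ
c (suc t) m = sumℚ (map term (distinctParts m m))
  where
  term : List ℕ → ℚ
  term p with length p ℕ.≟ suc t
  ... | yes _ = ((+ 1) / (suc t ℕ.* suc (suc t))) ℚ.* weightFrom 0 p
  ... | no  _ = 0ℚ

-- the right-hand side:  Σ_{t ≥ 1} ( Σ_{m=1}^{n-1} t · c_t(m) ) + 1.
-- For m ≤ n-1 and t ≥ n we have c_t(m) = 0 (empty sum), so the sum over
-- t ≥ 1 is the finite sum over 1 ≤ t ≤ n.
rhs : ℕ → ℚ
rhs n = sumℚ (map (λ t → sumℚ (map (λ m → ((+ t) / 1) ℚ.* c t m)
                                   (List.map suc (upTo (n ∸ 1)))))
                  (List.map suc (upTo n)))
        ℚ.+ 1ℚ

{-# OPTIONS --safe #-}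
-- A cycle containing a state {a,a} falls to {0,0}, which it visits exactly once, so strict patterns
-- correspond to simple cycles through {0,0}.  Between two throws the distance d between the balls is
-- constant; hence such a cycle is given by its distances 0, d₁, …, dₖ, 0 with the dᵢ > 0 distinct,
-- where the step from d to d′ takes d beats, or alternatively d − d′ beats if 0 < d′ < d (the thrown
-- ball lands below the other one), and the first step takes any number of beats.  Joining dᵢ to dᵢ₊₁
-- when the short step is used splits d₁, …, dₖ into an ordered list of decreasing blocks, and the steps
-- after the first take Σ (block maxima) beats.  Placing the values m, m−1, …, 1 one by one into the
-- blocks, each value meeting t blocks has t + 1 choices whether it opens a block (t + 1 positions) or
-- not (join one of t blocks, or stay unused).  For block maxima p₁ > ⋯ > pₜ the product of these choices
-- is 1/(t+1) ∏ ((i+1)/i)^{pᵢ}, that is, t times the summand of cₜ(m).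
module Submission where

open import Defs
open import Data.Bool using (Bool; true; false)
open import Data.Empty using (⊥; ⊥-elim)
open import Data.Integer as ℤ using (+_)
import Data.Integer.Properties as ℤₚ
open import Data.List using (List; []; _∷_; _++_; map; filter; concatMap; length; upTo; applyUpTo)
open import Data.List.Membership.Propositional using (_∈_; find; lose)
import Data.List.Membership.Propositional.Properties as ∈ₚ
import Data.List.Properties as Listₚ
open import Data.List.Relation.Unary.All as All using (All; []; _∷_)
import Data.List.Relation.Unary.All.Properties as Allₚ
open import Data.List.Relation.Unary.AllPairs using (AllPairs; []; _∷_)
import Data.List.Relation.Unary.AllPairs.Properties as AllPairsₚ
open import Data.List.Relation.Unary.Any using (Any; here; there)
open import Data.List.Relation.Unary.Unique.Propositional using (Unique)
import Data.List.Relation.Unary.Unique.Propositional.Properties as Uniqueₚ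
open import Data.Nat as ℕ using (ℕ; zero; suc; _+_; _∸_; _≤_; _<_; _≤?_; _<?_; s≤s; z≤n)
open import Data.Nat.DivMod using (_%_; m≡m%n+[m/n]*n; m%n<n; m%n%n≡m%n; m<n⇒m%n≡m; [m+n]%n≡m%n; [m+kn]%n≡m%n; %-distribˡ-+)
open import Data.Nat.ListAction using (sum)
import Data.Nat.Properties as ℕₚ
import Data.Nat.Solver as ℕSolver
open import Data.Product using (Σ; ∃; _×_; _,_; proj₁; proj₂)
open import Data.Rational as ℚ using (ℚ; 0ℚ; 1ℚ; _/_; toℚᵘ)
import Data.Rational.Properties as ℚₚ
import Data.Rational.Solver as ℚSolver
open import Data.Rational.Unnormalised as ℚᵘ using (mkℚᵘ; *≡*)
import Data.Rational.Unnormalised.Properties as ℚᵘₚ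
open import Data.Sum using (_⊎_; inj₁; inj₂)
open import Function using (_∘_)
open import Relation.Binary.PropositionalEquality
open import Relation.Nullary using (Dec; yes; no; ¬_)
open ≡-Reasoning

-- Weights of partitions into distinct parts

fromℕ : ℕ → ℚ
fromℕ n = (+ n) / 1

toℚᵘ-frac : ∀ a d → toℚᵘ ((+ a) / suc d) ℚᵘ.≃ mkℚᵘ (+ a) d
toℚᵘ-frac a d = ℚₚ.toℚᵘ-fromℚᵘ (mkℚᵘ (+ a) d)

-- `_/_` divides by a gcd and does not reduce on variables, so the product is compared in the
-- unnormalised rationals, where equality is cross-multiplication.
frac-* : ∀ a b c d e f → a ℕ.* c ℕ.* suc f ≡ e ℕ.* (suc b ℕ.* suc d) →
         ((+ a) / suc b) ℚ.* ((+ c) / suc d) ≡ (+ e) / suc f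
frac-* a b c d e f eq = ℚₚ.toℚᵘ-injective
  (ℚᵘₚ.≃-trans (ℚₚ.toℚᵘ-homo-* ((+ a) / suc b) ((+ c) / suc d))
  (ℚᵘₚ.≃-trans (ℚᵘₚ.*-cong (toℚᵘ-frac a b) (toℚᵘ-frac c d))
  (ℚᵘₚ.≃-trans (*≡* cross) (ℚᵘₚ.≃-sym (toℚᵘ-frac e f)))))
  where
  cross : (+ a ℤ.* + c) ℤ.* + suc f ≡ + e ℤ.* + (suc b ℕ.* suc d)
  cross = begin
    (+ a ℤ.* + c) ℤ.* + suc f   ≡⟨ cong (ℤ._* + suc f) (ℤₚ.pos-* a c) ⟨
    + (a ℕ.* c) ℤ.* + suc f     ≡⟨ ℤₚ.pos-* (a ℕ.* c) (suc f) ⟨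
    + (a ℕ.* c ℕ.* suc f)       ≡⟨ cong +_ eq ⟩
    + (e ℕ.* (suc b ℕ.* suc d)) ≡⟨ ℤₚ.pos-* e (suc b ℕ.* suc d) ⟩
    + e ℤ.* + (suc b ℕ.* suc d) ∎

fromℕ-* : ∀ a b → fromℕ (a ℕ.* b) ≡ fromℕ a ℚ.* fromℕ b
fromℕ-* a b = sym (frac-* a 0 b 0 (a ℕ.* b) 0 refl)

fromℕ-+ : ∀ a b → fromℕ (a + b) ≡ fromℕ a ℚ.+ fromℕ b
fromℕ-+ a b = sym (ℚₚ.toℚᵘ-injective
  (ℚᵘₚ.≃-trans (ℚₚ.toℚᵘ-homo-+ (fromℕ a) (fromℕ b))
  (ℚᵘₚ.≃-trans (ℚᵘₚ.+-cong (toℚᵘ-frac a 0) (toℚᵘ-frac b 0))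
  (ℚᵘₚ.≃-trans (*≡* (cong₂ (λ x y → (x ℤ.+ y) ℤ.* + 1) (ℤₚ.*-identityʳ (+ a)) (ℤₚ.*-identityʳ (+ b))))
               (ℚᵘₚ.≃-sym (toℚᵘ-frac (a + b) 0))))))

^ℚ-distrib-* : ∀ x y k → (x ℚ.* y) ^ℚ k ≡ (x ^ℚ k) ℚ.* (y ^ℚ k)
^ℚ-distrib-* x y zero    = refl
^ℚ-distrib-* x y (suc k) = begin
  x ℚ.* y ℚ.* ((x ℚ.* y) ^ℚ k)             ≡⟨ cong (x ℚ.* y ℚ.*_) (^ℚ-distrib-* x y k) ⟩
  x ℚ.* y ℚ.* ((x ^ℚ k) ℚ.* (y ^ℚ k))     ≡⟨ ℚ-interchange x y (x ^ℚ k) (y ^ℚ k) ⟩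
  x ℚ.* (x ^ℚ k) ℚ.* (y ℚ.* (y ^ℚ k))     ∎
  where
  ℚ-interchange : ∀ a b c d → a ℚ.* b ℚ.* (c ℚ.* d) ≡ a ℚ.* c ℚ.* (b ℚ.* d)
  ℚ-interchange = solve 4 (λ a b c d → a :* b :* (c :* d) := a :* c :* (b :* d)) refl
    where open ℚSolver.+-*-Solver

sumℚ-++ : ∀ xs ys → sumℚ (xs ++ ys) ≡ sumℚ xs ℚ.+ sumℚ ys
sumℚ-++ []       ys = sym (ℚₚ.+-identityˡ _)
sumℚ-++ (x ∷ xs) ys = trans (cong (x ℚ.+_) (sumℚ-++ xs ys)) (sym (ℚₚ.+-assoc x _ _))

module _ {A : Set} where

  sumℚ-cong : ∀ {f g : A → ℚ} xs → (∀ {x} → x ∈ xs → f x ≡ g x) →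
              sumℚ (map f xs) ≡ sumℚ (map g xs)
  sumℚ-cong []       eq = refl
  sumℚ-cong (x ∷ xs) eq = cong₂ ℚ._+_ (eq (here refl)) (sumℚ-cong xs (eq ∘ there))

  sumℚ-*ˡ : ∀ a (f : A → ℚ) xs → sumℚ (map (λ x → a ℚ.* f x) xs) ≡ a ℚ.* sumℚ (map f xs)
  sumℚ-*ˡ a f []       = sym (ℚₚ.*-zeroʳ a)
  sumℚ-*ˡ a f (x ∷ xs) = trans (cong (a ℚ.* f x ℚ.+_) (sumℚ-*ˡ a f xs)) (sym (ℚₚ.*-distribˡ-+ a _ _))

  sumℚ-0 : ∀ (xs : List A) → sumℚ (map (λ _ → 0ℚ) xs) ≡ 0ℚ
  sumℚ-0 []       = refl
  sumℚ-0 (x ∷ xs) = trans (ℚₚ.+-identityˡ _) (sumℚ-0 xs)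

  sumℚ-+ : ∀ (f g : A → ℚ) xs → sumℚ (map (λ x → f x ℚ.+ g x) xs) ≡ sumℚ (map f xs) ℚ.+ sumℚ (map g xs)
  sumℚ-+ f g []       = refl
  sumℚ-+ f g (x ∷ xs) = trans (cong (f x ℚ.+ g x ℚ.+_) (sumℚ-+ f g xs)) (ℚ-interchange (f x) (g x) _ _)
    where
    ℚ-interchange : ∀ a b c d → a ℚ.+ b ℚ.+ (c ℚ.+ d) ≡ a ℚ.+ c ℚ.+ (b ℚ.+ d)
    ℚ-interchange = solve 4 (λ a b c d → a :+ b :+ (c :+ d) := a :+ c :+ (b :+ d)) refl
      where open ℚSolver.+-*-Solver

sumℚ-swap : ∀ {A B : Set} (f : A → B → ℚ) xs ys →
            sumℚ (map (λ x → sumℚ (map (f x) ys)) xs) ≡ sumℚ (map (λ y → sumℚ (map (λ x → f x y) xs)) ys)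
sumℚ-swap f []       ys = sym (sumℚ-0 ys)
sumℚ-swap f (x ∷ xs) ys = trans (cong (sumℚ (map (f x) ys) ℚ.+_) (sumℚ-swap f xs ys))
                                (sym (sumℚ-+ (f x) _ ys))

-- A Kronecker delta sorting partitions by length. Its case split is that of the summand of `c`, so
-- that one `with` in `t*term-δ` decides both.
δℚ : ℕ → ℕ → ℚ → ℚ
δℚ i j q with i ℕ.≟ j
... | yes _ = q
... | no  _ = 0ℚ

δℚ-refl : ∀ i q → δℚ i i q ≡ q
δℚ-refl i q with i ℕ.≟ i
... | yes _   = refl
... | no  i≢i = ⊥-elim (i≢i refl)

δℚ-≢ : ∀ {i j} q → i ≢ j → δℚ i j q ≡ 0ℚ
δℚ-≢ {i} {j} q i≢j with i ℕ.≟ j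
... | yes i≡j = ⊥-elim (i≢j i≡j)
... | no  _   = refl

sumℚ-δ-∉ : ∀ n (f : ℕ → ℕ) {j} q → (∀ t → j ≢ f t) → sumℚ (applyUpTo (λ t → δℚ j (f t) q) n) ≡ 0ℚ
sumℚ-δ-∉ zero    f q ne = refl
sumℚ-δ-∉ (suc n) f q ne = cong₂ ℚ._+_ (δℚ-≢ q (ne 0)) (sumℚ-δ-∉ n (f ∘ suc) q (ne ∘ suc))

sumℚ-δ : ∀ n (f : ℕ → ℕ) k q → (∀ {x y} → f x ≡ f y → x ≡ y) → k < n →
         sumℚ (applyUpTo (λ t → δℚ (f k) (f t) q) n) ≡ q
sumℚ-δ (suc n) f zero q inj _ = trans
  (cong₂ ℚ._+_ (δℚ-refl (f 0) q) (sumℚ-δ-∉ n (f ∘ suc) q (λ t eq → ℕₚ.0≢1+n (inj eq))))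
  (ℚₚ.+-identityʳ q)
sumℚ-δ (suc n) f (suc k) q inj (s≤s k<n) = trans
  (cong₂ ℚ._+_ (δℚ-≢ q (λ eq → ℕₚ.0≢1+n (inj (sym eq)))) (sumℚ-δ n (f ∘ suc) k q (ℕₚ.suc-injective ∘ inj) k<n))
  (ℚₚ.+-identityˡ q)

-- The number of ways to place the values b, …, 1 when t blocks exist already, with new block maxima of sum m.
placements : ℕ → ℕ → ℕ → ℕ
placements zero    t zero    = 1
placements zero    t (suc m) = 0
placements (suc b) t m with suc b ≤? m
... | yes _ = suc t ℕ.* placements b t m + suc t ℕ.* placements b (suc t) (m ∸ suc b)
... | no  _ = suc t ℕ.* placements b t m

-- The number of these placements whose new block maxima are p.
weight : ℕ → ℕ → List ℕ → ℚ
weight b t p = (fromℕ (suc t) ^ℚ b) ℚ.* (weightFrom t p ℚ.* ((+ suc t) / suc (t + length p)))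

weight-skip : ∀ b t p → weight (suc b) t p ≡ fromℕ (suc t) ℚ.* weight b t p
weight-skip b t p = ℚₚ.*-assoc (fromℕ (suc t)) (fromℕ (suc t) ^ℚ b) _

-- The value `suc b` opens a block in one of `suc t` positions, and `suc t` blocks exist afterwards.
-- In `weight`, the factor of a block maximum raises the number of choices for every value up to
-- that maximum. It is one too many for the maximum itself, which still meets the former number of
-- blocks; these corrections telescope to the last fraction of `weight`.
weight-∷ : ∀ b t p → weight (suc b) t (suc b ∷ p) ≡ fromℕ (suc t) ℚ.* weight b (suc t) p
weight-∷ b t p = begin
  A ^ℚ suc b ℚ.* (R ^ℚ suc b ℚ.* V ℚ.* Q₁)     ≡⟨ cong (λ x → A ^ℚ suc b ℚ.* x) (ℚₚ.*-assoc (R ^ℚ suc b) V Q₁) ⟩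
  A ^ℚ suc b ℚ.* (R ^ℚ suc b ℚ.* (V ℚ.* Q₁))   ≡⟨ ℚₚ.*-assoc (A ^ℚ suc b) (R ^ℚ suc b) _ ⟨
  A ^ℚ suc b ℚ.* R ^ℚ suc b ℚ.* (V ℚ.* Q₁)     ≡⟨ cong (ℚ._* (V ℚ.* Q₁)) (^ℚ-distrib-* A R (suc b)) ⟨
  (A ℚ.* R) ^ℚ suc b ℚ.* (V ℚ.* Q₁)           ≡⟨ cong (λ x → x ^ℚ suc b ℚ.* (V ℚ.* Q₁)) AR≡A′ ⟩
  A′ ℚ.* A′ ^ℚ b ℚ.* (V ℚ.* Q₁)               ≡⟨ rearrange A′ (A′ ^ℚ b) V Q₁ ⟩
  A′ ^ℚ b ℚ.* V ℚ.* (A′ ℚ.* Q₁)               ≡⟨ cong (A′ ^ℚ b ℚ.* V ℚ.*_) cross ⟩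
  A′ ^ℚ b ℚ.* V ℚ.* (A ℚ.* Q₂)                ≡⟨ rearrange A (A′ ^ℚ b) V Q₂ ⟨
  A ℚ.* A′ ^ℚ b ℚ.* (V ℚ.* Q₂)                ≡⟨ ℚₚ.*-assoc A (A′ ^ℚ b) _ ⟩
  A ℚ.* (A′ ^ℚ b ℚ.* (V ℚ.* Q₂))              ∎
  where
  infixr 8 _^_
  A A′ R V Q₁ Q₂ : ℚ
  A  = fromℕ (suc t)
  A′ = fromℕ (suc (suc t))
  R  = (+ suc (suc t)) / suc t
  V  = weightFrom (suc t) p
  Q₁ = (+ suc t) / suc (t + suc (length p))
  Q₂ = (+ suc (suc t)) / suc (suc t + length p)
  _^_ = _^ℚ_
  AR≡A′ : A ℚ.* R ≡ A′
  AR≡A′ = frac-* (suc t) 0 (suc (suc t)) t (suc (suc t)) 0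
    (solve 1 (λ t → (con 1 :+ t) :* (con 2 :+ t) :* con 1 := (con 2 :+ t) :* (con 1 :* (con 1 :+ t))) refl t)
    where open ℕSolver.+-*-Solver
  cross : A′ ℚ.* Q₁ ≡ A ℚ.* Q₂
  cross = trans
    (frac-* (suc (suc t)) 0 (suc t) q (suc t ℕ.* suc (suc t)) q
      (solve 2 (λ t q → (con 2 :+ t) :* (con 1 :+ t) :* (con 1 :+ q) := ((con 1 :+ t) :* (con 2 :+ t)) :* (con 1 :* (con 1 :+ q))) refl t q))
    (sym (trans (cong (λ x → A ℚ.* ((+ suc (suc t)) / suc x)) (sym (ℕₚ.+-suc t (length p))))
      (frac-* (suc t) 0 (suc (suc t)) q (suc t ℕ.* suc (suc t)) q
        (solve 2 (λ t q → (con 1 :+ t) :* (con 2 :+ t) :* (con 1 :+ q) := ((con 1 :+ t) :* (con 2 :+ t)) :* (con 1 :* (con 1 :+ q))) refl t q))))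
    where
    open ℕSolver.+-*-Solver
    q = t + suc (length p)
  rearrange : ∀ a x v q → a ℚ.* x ℚ.* (v ℚ.* q) ≡ x ℚ.* v ℚ.* (a ℚ.* q)
  rearrange = solve 4 (λ a x v q → a :* x :* (v :* q) := x :* v :* (a :* q)) refl
    where open ℚSolver.+-*-Solver

sumℚ-scale : ∀ a z {f g : List ℕ → ℚ} l → (∀ p → f p ≡ fromℕ a ℚ.* g p) →
             fromℕ z ≡ sumℚ (map g l) → fromℕ (a ℕ.* z) ≡ sumℚ (map f l)
sumℚ-scale a z {f} {g} l f≡ z≡ = begin
  fromℕ (a ℕ.* z)                        ≡⟨ fromℕ-* a z ⟩
  fromℕ a ℚ.* fromℕ z                    ≡⟨ cong (fromℕ a ℚ.*_) z≡ ⟩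
  fromℕ a ℚ.* sumℚ (map g l)             ≡⟨ sumℚ-*ˡ (fromℕ a) g l ⟨
  sumℚ (map (λ p → fromℕ a ℚ.* g p) l)   ≡⟨ cong sumℚ (Listₚ.map-cong f≡ l) ⟨
  sumℚ (map f l)                         ∎

-- `placements` and `distinctParts` split alike, according to whether `suc b` is a block maximum;
-- `weight-skip` and `weight-∷` are the two cases.
placements≡∑weight : ∀ b t m → fromℕ (placements b t m) ≡ sumℚ (map (weight b t) (distinctParts b m))
placements≡∑weight zero t zero = begin
  1ℚ                                  ≡⟨ frac-* 1 0 (suc t) t 1 0 (ℕₚ.*-comm (1 ℕ.* suc t) 1) ⟨
  1ℚ ℚ.* ((+ suc t) / suc t)          ≡⟨ cong (λ x → 1ℚ ℚ.* ((+ suc t) / suc x)) (ℕₚ.+-identityʳ t) ⟨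
  1ℚ ℚ.* ((+ suc t) / suc (t + 0))    ≡⟨ ℚₚ.*-identityˡ _ ⟨
  1ℚ ℚ.* (1ℚ ℚ.* ((+ suc t) / suc (t + 0))) ≡⟨ ℚₚ.+-identityʳ _ ⟨
  1ℚ ℚ.* (1ℚ ℚ.* ((+ suc t) / suc (t + 0))) ℚ.+ 0ℚ ∎
placements≡∑weight zero    t (suc m) = refl
placements≡∑weight (suc b) t m with suc b ≤? m
... | no  _ = sumℚ-scale (suc t) (placements b t m) (distinctParts b m) (weight-skip b t) (placements≡∑weight b t m)
... | yes _ = begin
  fromℕ (suc t ℕ.* x + suc t ℕ.* y)  ≡⟨ fromℕ-+ (suc t ℕ.* x) (suc t ℕ.* y) ⟩
  fromℕ (suc t ℕ.* x) ℚ.+ fromℕ (suc t ℕ.* y)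
    ≡⟨ cong₂ ℚ._+_ (sumℚ-scale (suc t) x ps (weight-skip b t) (placements≡∑weight b t m))
                   (sumℚ-scale (suc t) y qs (weight-∷ b t) (placements≡∑weight b (suc t) (m ∸ suc b))) ⟩
  sumℚ (map (weight (suc b) t) ps) ℚ.+ sumℚ (map (λ p → weight (suc b) t (suc b ∷ p)) qs)
    ≡⟨ cong (λ l → sumℚ (map (weight (suc b) t) ps) ℚ.+ sumℚ l) (Listₚ.map-∘ qs) ⟩
  sumℚ (map (weight (suc b) t) ps) ℚ.+ sumℚ (map (weight (suc b) t) (map (suc b ∷_) qs))
    ≡⟨ sumℚ-++ (map (weight (suc b) t) ps) _ ⟨
  sumℚ (map (weight (suc b) t) ps ++ map (weight (suc b) t) (map (suc b ∷_) qs))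
    ≡⟨ cong sumℚ (Listₚ.map-++ (weight (suc b) t) ps (map (suc b ∷_) qs)) ⟨
  sumℚ (map (weight (suc b) t) (ps ++ map (suc b ∷_) qs)) ∎
  where
  x = placements b t m
  y = placements b (suc t) (m ∸ suc b)
  ps = distinctParts b m
  qs = distinctParts b (m ∸ suc b)

length-distinctParts : ∀ b m {p} → p ∈ distinctParts b m → length p ≤ b
length-distinctParts zero    zero (here refl) = z≤n
length-distinctParts (suc b) m p∈ with suc b ≤? m
... | no  _ = ℕₚ.m≤n⇒m≤1+n (length-distinctParts b m p∈)
... | yes _ with ∈ₚ.∈-++⁻ (distinctParts b m) p∈
...   | inj₁ p∈ˡ = ℕₚ.m≤n⇒m≤1+n (length-distinctParts b m p∈ˡ)
...   | inj₂ p∈ʳ with ∈ₚ.∈-map⁻ (suc b ∷_) p∈ʳ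
...     | q , q∈ , refl = s≤s (length-distinctParts b (m ∸ suc b) q∈)

[]∉distinctParts : ∀ b m → [] ∈ distinctParts b (suc m) → ⊥
[]∉distinctParts (suc b) m []∈ with suc b ≤? suc m
... | no  _ = []∉distinctParts b m []∈
... | yes _ with ∈ₚ.∈-++⁻ (distinctParts b (suc m)) []∈
...   | inj₁ []∈ˡ = []∉distinctParts b m []∈ˡ
...   | inj₂ []∈ʳ with ∈ₚ.∈-map⁻ (suc b ∷_) []∈ʳ
...     | q , q∈ , ()

1^ℚ : ∀ k → 1ℚ ^ℚ k ≡ 1ℚ
1^ℚ zero    = refl
1^ℚ (suc k) = trans (ℚₚ.*-identityˡ _) (1^ℚ k)

-- The factor cancels in 1/(t(t+1)), leaving 1/(t+1), which is the last fraction of `weight` when no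
-- block exists at the start.
t*term : ∀ t m p → length p ≡ suc t →
         fromℕ (suc t) ℚ.* (((+ 1) / (suc t ℕ.* suc (suc t))) ℚ.* weightFrom 0 p) ≡ weight m 0 p
t*term t m p len = begin
  fromℕ (suc t) ℚ.* (((+ 1) / (suc t ℕ.* suc (suc t))) ℚ.* W) ≡⟨ ℚₚ.*-assoc (fromℕ (suc t)) _ W ⟨
  fromℕ (suc t) ℚ.* ((+ 1) / (suc t ℕ.* suc (suc t))) ℚ.* W
    ≡⟨ cong (ℚ._* W) (frac-* (suc t) 0 1 _ 1 (suc t)
        (solve 1 (λ t → (con 1 :+ t) :* con 1 :* (con 2 :+ t) := con 1 :* (con 1 :* ((con 1 :+ t) :* (con 2 :+ t)))) refl t)) ⟩
  ((+ 1) / suc (suc t)) ℚ.* W            ≡⟨ ℚₚ.*-comm _ W ⟩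
  W ℚ.* ((+ 1) / suc (suc t))            ≡⟨ cong (λ l → W ℚ.* ((+ 1) / suc l)) len ⟨
  W ℚ.* ((+ 1) / suc (length p))         ≡⟨ ℚₚ.*-identityˡ _ ⟨
  1ℚ ℚ.* (W ℚ.* ((+ 1) / suc (length p))) ≡⟨ cong (ℚ._* (W ℚ.* ((+ 1) / suc (length p)))) (1^ℚ m) ⟨
  weight m 0 p ∎
  where
  W = weightFrom 0 p
  open ℕSolver.+-*-Solver

mutual
  t*c : ∀ t m → fromℕ (suc t) ℚ.* c (suc t) m ≡
                sumℚ (map (λ p → δℚ (length p) (suc t) (weight m 0 p)) (distinctParts m m))
  t*c t m = trans (sym (sumℚ-*ˡ (fromℕ (suc t)) _ (distinctParts m m)))
                  (cong sumℚ (Listₚ.map-cong (t*term-δ t m) (distinctParts m m)))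

  -- The left-hand side is a where-function local to c, so it can only be named by unification.
  t*term-δ : ∀ t m p → fromℕ (suc t) ℚ.* _ ≡ δℚ (length p) (suc t) (weight m 0 p)
  t*term-δ t m p with length p ℕ.≟ suc t
  ... | yes len = t*term t m p len
  ... | no  _   = ℚₚ.*-zeroʳ (fromℕ (suc t))

-- A partition of `suc m` has exactly one length, and this lies between 1 and `n`. So the sum over t
-- of the deltas returns each weight once.
∑t*c : ∀ n m → suc m ≤ n →
       sumℚ (map (λ t → fromℕ t ℚ.* c t (suc m)) (map suc (upTo n))) ≡ fromℕ (placements (suc m) 0 (suc m))
∑t*c n m m<n = begin
  sumℚ (map (λ t → fromℕ t ℚ.* c t M) (map suc (upTo n)))
    ≡⟨ cong sumℚ (Listₚ.map-∘ (upTo n)) ⟨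
  sumℚ (map (λ t → fromℕ (suc t) ℚ.* c (suc t) M) (upTo n))
    ≡⟨ cong sumℚ (Listₚ.map-cong (λ t → t*c t M) (upTo n)) ⟩
  sumℚ (map (λ t → sumℚ (map (λ p → δℚ (length p) (suc t) (weight M 0 p)) ps)) (upTo n))
    ≡⟨ sumℚ-swap (λ t p → δℚ (length p) (suc t) (weight M 0 p)) (upTo n) ps ⟩
  sumℚ (map (λ p → sumℚ (map (λ t → δℚ (length p) (suc t) (weight M 0 p)) (upTo n))) ps)
    ≡⟨ sumℚ-cong ps collapse ⟩
  sumℚ (map (weight M 0) ps)
    ≡⟨ placements≡∑weight M 0 M ⟨
  fromℕ (placements M 0 M) ∎
  where
  M = suc m
  ps = distinctParts M M
  collapse : ∀ {p} → p ∈ ps →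
             sumℚ (map (λ t → δℚ (length p) (suc t) (weight M 0 p)) (upTo n)) ≡ weight M 0 p
  collapse {[]}    p∈ = ⊥-elim ([]∉distinctParts M m p∈)
  collapse {x ∷ p} p∈ = trans (cong sumℚ (Listₚ.map-upTo _ n))
    (sumℚ-δ n suc (length p) _ ℕₚ.suc-injective (ℕₚ.≤-trans (length-distinctParts M M p∈) m<n))

∑-fromℕ : ∀ {A : Set} (f : A → ℕ) xs → sumℚ (map (fromℕ ∘ f) xs) ≡ fromℕ (sum (map f xs))
∑-fromℕ f []       = refl
∑-fromℕ f (x ∷ xs) = trans (cong (fromℕ (f x) ℚ.+_) (∑-fromℕ f xs)) (sym (fromℕ-+ (f x) _))

-- The summand for m = 0 is 1 and supplies the final `+ 1` of `rhs`; it counts the empty path.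
rhs≡∑placements : ∀ n → fromℕ (sum (map (λ m → placements m 0 m) (upTo (suc n)))) ≡ rhs (suc n)
rhs≡∑placements n = begin
  fromℕ (1 + sum (map W (applyUpTo suc n)))
    ≡⟨ fromℕ-+ 1 (sum (map W (applyUpTo suc n))) ⟩
  1ℚ ℚ.+ fromℕ (sum (map W (applyUpTo suc n)))
    ≡⟨ ℚₚ.+-comm 1ℚ (fromℕ (sum (map W (applyUpTo suc n)))) ⟩
  fromℕ (sum (map W (applyUpTo suc n))) ℚ.+ 1ℚ
    ≡⟨ cong (ℚ._+ 1ℚ) inner ⟨
  rhs (suc n) ∎
  where
  W : ℕ → ℕ
  W m = placements m 0 m
  bound : ∀ {m} → m ∈ map suc (upTo n) →
          sumℚ (map (λ t → fromℕ t ℚ.* c t m) (map suc (upTo (suc n)))) ≡ fromℕ (W m)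
  bound m∈ with ∈ₚ.∈-map⁻ suc m∈
  ... | k , k∈ , refl = ∑t*c (suc n) k (ℕₚ.m≤n⇒m≤1+n (∈ₚ.∈-upTo⁻ k∈))
  inner : sumℚ (map (λ t → sumℚ (map (λ m → fromℕ t ℚ.* c t m) (map suc (upTo n)))) (map suc (upTo (suc n))))
          ≡ fromℕ (sum (map W (applyUpTo suc n)))
  inner = begin
    _ ≡⟨ sumℚ-swap (λ t m → fromℕ t ℚ.* c t m) (map suc (upTo (suc n))) (map suc (upTo n)) ⟩
    sumℚ (map (λ m → sumℚ (map (λ t → fromℕ t ℚ.* c t m) (map suc (upTo (suc n))))) (map suc (upTo n)))
      ≡⟨ sumℚ-cong (map suc (upTo n)) bound ⟩
    sumℚ (map (fromℕ ∘ W) (map suc (upTo n))) ≡⟨ ∑-fromℕ W (map suc (upTo n)) ⟩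
    fromℕ (sum (map W (map suc (upTo n))))     ≡⟨ cong (λ l → fromℕ (sum (map W l))) (Listₚ.map-upTo suc n) ⟩
    fromℕ (sum (map W (applyUpTo suc n)))      ∎

-- Paths of distances

-- A path lists the distances d₁, …, dₖ, each with a flag saying whether it continues its predecessor's
-- block (true) or opens a new block (false).
Entry : Set
Entry = Bool × ℕ

Path : Set
Path = List Entry

-- p is the distance preceding the path; p = 0 forces the first entry to open a block.
data Admissible : ℕ → Path → Set where
  []   : ∀ {p} → Admissible p []
  attached  : ∀ {p x xs} → x < p → Admissible x xs → Admissible p ((true , x) ∷ xs)
  jump : ∀ {p x xs} → Admissible x xs → Admissible p ((false , x) ∷ xs)

Distinct : Path → Set
Distinct = AllPairs (λ e e′ → proj₂ e ≢ proj₂ e′)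

Above : ℕ → Path → Set
Above b = All (λ e → b < proj₂ e)

-- An attached entry is smaller than its predecessor, so the entry opening a block is its maximum:
-- this is the sum of the block maxima.
cost : Path → ℕ
cost []                 = 0
cost ((true  , x) ∷ xs) = cost xs
cost ((false , x) ∷ xs) = x + cost xs

blocks : Path → ℕ
blocks []                 = 0
blocks ((true  , x) ∷ xs) = blocks xs
blocks ((false , x) ∷ xs) = suc (blocks xs)

tail-Admissible : ∀ {p f x xs} → Admissible p ((f , x) ∷ xs) → Admissible x xs
tail-Admissible (attached _ ok) = ok
tail-Admissible (jump ok)  = ok

-- The paths in front of which a new smallest entry may be put: an attached first entry would have
-- to be smaller still.
data Free : Path → Set where
  []   : Free []
  jump : ∀ {x xs} → Free ((false , x) ∷ xs)

Free⇒Admissible : ∀ {p q v} → Free v → Admissible p v → Admissible q v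
Free⇒Admissible [] [] = []
Free⇒Admissible jump (jump ok) = jump ok

Admissible-above⇒Free : ∀ {p v} → Admissible p v → Above p v → Free v
Admissible-above⇒Free []            _           = []
Admissible-above⇒Free (attached x<p _)   (p<x ∷ _)   = ⊥-elim (ℕₚ.<-asym x<p p<x)
Admissible-above⇒Free (jump _)      _           = jump

-- Insertion of a new smallest value

data Ins (e : Entry) : Path → Path → Set where
  here  : ∀ {v} → Free v → Ins e v (e ∷ v)
  there : ∀ {y v w} → Ins e v w → Ins e (y ∷ v) (y ∷ w)

ins : Entry → Path → List Path
ins e []                = (e ∷ []) ∷ []
ins e ((false , y) ∷ v) = (e ∷ (false , y) ∷ v) ∷ map ((false , y) ∷_) (ins e v)
ins e ((true  , y) ∷ v) = map ((true , y) ∷_) (ins e v)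

ins⁻ : ∀ {e} S {T} → T ∈ ins e S → Ins e S T
ins⁻ []                (here refl) = here []
ins⁻ ((false , y) ∷ v) (here refl) = here jump
ins⁻ ((false , y) ∷ v) (there T∈) with ∈ₚ.∈-map⁻ _ T∈
... | w , w∈ , refl = there (ins⁻ v w∈)
ins⁻ ((true , y) ∷ v) T∈ with ∈ₚ.∈-map⁻ _ T∈
... | w , w∈ , refl = there (ins⁻ v w∈)

ins⁺ : ∀ {e S T} → Ins e S T → T ∈ ins e S
ins⁺ (here [])                 = here refl
ins⁺ (here jump)               = here refl
ins⁺ (there {false , y} i)     = there (∈ₚ.∈-map⁺ _ (ins⁺ i))
ins⁺ (there {true  , y} i)     = ∈ₚ.∈-map⁺ _ (ins⁺ i)

-- There is one position in front of each block opening and one at the end of the path.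
length-ins : ∀ e S → length (ins e S) ≡ suc (blocks S)
length-ins e []                = refl
length-ins e ((false , y) ∷ v) = cong suc (trans (Listₚ.length-map _ (ins e v)) (length-ins e v))
length-ins e ((true  , y) ∷ v) = trans (Listₚ.length-map _ (ins e v)) (length-ins e v)

-- An attached entry may go anywhere but in front of the whole path.
attach : ℕ → Path → List Path
attach x []      = []
attach x (y ∷ v) = map (y ∷_) (ins (true , x) v)

attach⁻ : ∀ {x} S {T} → T ∈ attach x S → Ins (true , x) S T
attach⁻ (y ∷ v) T∈ with ∈ₚ.∈-map⁻ _ T∈
... | w , w∈ , refl = there (ins⁻ v w∈)

attach⁺ : ∀ {x S T} → Admissible 0 T → Ins (true , x) S T → T ∈ attach x S
attach⁺ (attached () _) (here _)
attach⁺ ok         (there i) = ∈ₚ.∈-map⁺ _ (ins⁺ i)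

length-attach : ∀ x {S} → Admissible 0 S → length (attach x S) ≡ blocks S
length-attach x []                     = refl
length-attach x (attached () _)
length-attach x (jump {x = y} {v} ok)  = trans (Listₚ.length-map _ (ins (true , x) v)) (length-ins _ v)

Ins-All : ∀ {P : Entry → Set} {e S T} → P e → All P S → Ins e S T → All P T
Ins-All pe ps       (here _)  = pe ∷ ps
Ins-All pe (p ∷ ps) (there i) = p ∷ Ins-All pe ps i

Ins-Distinct : ∀ {e S T} → Above (proj₂ e) S → Distinct S → Ins e S T → Distinct T
Ins-Distinct ab       d        (here _)  = All.map ℕₚ.<⇒≢ ab ∷ d
Ins-Distinct (a ∷ ab) (n ∷ d)  (there i) = Ins-All (ℕₚ.<⇒≢ a ∘ sym) n i ∷ Ins-Distinct ab d i

Ins-Admissible-false : ∀ {p x S T} → Admissible p S → Ins (false , x) S T → Admissible p T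
Ins-Admissible-false ok          (here fr) = jump (Free⇒Admissible fr ok)
Ins-Admissible-false (attached lt ok) (there i) = attached lt (Ins-Admissible-false ok i)
Ins-Admissible-false (jump ok)   (there i) = jump (Ins-Admissible-false ok i)

Ins-Admissible-true : ∀ {p x S T} → x < p → Above x S → Admissible p S → Ins (true , x) S T → Admissible p T
Ins-Admissible-true x<p ab       ok          (here fr) = attached x<p (Free⇒Admissible fr ok)
Ins-Admissible-true x<p (a ∷ ab) (attached lt ok) (there i) = attached lt (Ins-Admissible-true a ab ok i)
Ins-Admissible-true x<p (a ∷ ab) (jump ok)   (there i) = jump (Ins-Admissible-true a ab ok i)

attach-Admissible : ∀ {x S T} → Above x S → Admissible 0 S → T ∈ attach x S → Admissible 0 T
attach-Admissible {S = y ∷ v} (a ∷ ab) ok T∈ with ∈ₚ.∈-map⁻ _ T∈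
attach-Admissible {S = y ∷ v} (a ∷ ab) (jump ok) T∈ | w , w∈ , refl = jump (Ins-Admissible-true a ab ok (ins⁻ v w∈))

cost-Ins-true : ∀ {x S T} → Ins (true , x) S T → cost T ≡ cost S
cost-Ins-true (here _)              = refl
cost-Ins-true (there {true  , _} i) = cost-Ins-true i
cost-Ins-true (there {false , y} i) = cong (y ℕ.+_) (cost-Ins-true i)

cost-Ins-false : ∀ {x S T} → Ins (false , x) S T → cost T ≡ cost S + x
cost-Ins-false {x} {S} (here _)            = ℕₚ.+-comm x (cost S)
cost-Ins-false (there {true  , _} i)       = cost-Ins-false i
cost-Ins-false {x} (there {false , y} {v} i) = trans (cong (y ℕ.+_) (cost-Ins-false i)) (sym (ℕₚ.+-assoc y (cost v) x))

blocks-Ins-true : ∀ {x S T} → Ins (true , x) S T → blocks T ≡ blocks S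
blocks-Ins-true (here _)              = refl
blocks-Ins-true (there {true  , _} i) = blocks-Ins-true i
blocks-Ins-true (there {false , y} i) = cong suc (blocks-Ins-true i)

blocks-Ins-false : ∀ {x S T} → Ins (false , x) S T → blocks T ≡ suc (blocks S)
blocks-Ins-false (here _)              = refl
blocks-Ins-false (there {true  , _} i) = blocks-Ins-false i
blocks-Ins-false (there {false , y} i) = cong suc (blocks-Ins-false i)

Ins-irrefl : ∀ {e S} → ¬ Ins e S S
Ins-irrefl (there i) = Ins-irrefl i

-- Opaque, so that filter is stuck on this very term and with-abstraction on it goes through.
abstract
  _<ₐ?_ : ∀ b x → Dec (b < x)
  _<ₐ?_ = _<?_

keep : ℕ → Path → Path
keep b = filter (λ e → b <ₐ? proj₂ e)

keep-above : ∀ {b S} → Above b S → keep b S ≡ S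
keep-above = Listₚ.filter-all _

keep-Ins : ∀ {f x S T} → Above x S → Ins (f , x) S T → keep x T ≡ S
keep-Ins {x = x} ab (here _) = trans (Listₚ.filter-reject (λ e → x <ₐ? proj₂ e) (ℕₚ.<-irrefl refl)) (keep-above ab)
keep-Ins {x = x} (a ∷ ab) (there i) = trans (Listₚ.filter-accept (λ e → x <ₐ? proj₂ e) a) (cong (_ ∷_) (keep-Ins ab i))

keep-keep : ∀ {b b′} → b ≤ b′ → ∀ T → keep b′ (keep b T) ≡ keep b′ T
keep-keep b≤b′ [] = refl
keep-keep {b} {b′} b≤b′ (e ∷ T) with b <ₐ? proj₂ e
... | no ¬lt = trans (keep-keep b≤b′ T) (sym (Listₚ.filter-reject (λ e → b′ <ₐ? proj₂ e) (¬lt ∘ ℕₚ.≤-<-trans b≤b′)))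
... | yes _ with b′ <ₐ? proj₂ e
...   | yes lt = cong (e ∷_) (keep-keep b≤b′ T)
...   | no ¬lt = keep-keep b≤b′ T

keep-Admissible : ∀ b {p T} → Admissible p T → Admissible p (keep b T)
-- Entries attached after a dropped entry are smaller and are dropped as well. The next survivor is
-- therefore a jump, which is admissible after any `q`.
keep-Admissible-low : ∀ b {p q T} → p ≤ b → Admissible p T → Admissible q (keep b T)

keep-Admissible b [] = []
keep-Admissible b (attached {x = x} lt ok) with b <ₐ? x
... | yes _ = attached lt (keep-Admissible b ok)
... | no ¬lt = keep-Admissible-low b (ℕₚ.≮⇒≥ ¬lt) ok
keep-Admissible b (jump {x = x} ok) with b <ₐ? x
... | yes _ = jump (keep-Admissible b ok)
... | no ¬lt = keep-Admissible-low b (ℕₚ.≮⇒≥ ¬lt) ok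

keep-Admissible-low b p≤b [] = []
keep-Admissible-low b p≤b (attached {x = x} lt ok) with b <ₐ? x
... | yes b<x = ⊥-elim (ℕₚ.<-asym b<x (ℕₚ.<-≤-trans lt p≤b))
... | no ¬lt = keep-Admissible-low b (ℕₚ.≮⇒≥ ¬lt) ok
keep-Admissible-low b p≤b (jump {x = x} ok) with b <ₐ? x
... | yes _ = jump (keep-Admissible b ok)
... | no ¬lt = keep-Admissible-low b (ℕₚ.≮⇒≥ ¬lt) ok

cost-keep : ∀ b T → cost (keep b T) ≤ cost T
cost-keep b [] = z≤n
cost-keep b ((true , x) ∷ T) with b <ₐ? x
... | yes _ = cost-keep b T
... | no  _ = cost-keep b T
cost-keep b ((false , x) ∷ T) with b <ₐ? x
... | yes _ = ℕₚ.+-monoʳ-≤ x (cost-keep b T)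
... | no  _ = ℕₚ.≤-trans (cost-keep b T) (ℕₚ.m≤n+m (cost T) x)

-- Enumeration of paths by placing values in decreasing order

extensions : ℕ → Path → ℕ → List Path
extensions zero    S zero    = S ∷ []
extensions zero    S (suc m) = []
extensions (suc b) S m with suc b ≤? m
... | yes _ = concatMap (λ T → extensions b T m) (S ∷ attach (suc b) S)
           ++ concatMap (λ T → extensions b T (m ∸ suc b)) (ins (false , suc b) S)
... | no  _ = concatMap (λ T → extensions b T m) (S ∷ attach (suc b) S)

record Good (b : ℕ) (S : Path) : Set where
  constructor good
  field
    ok       : Admissible 0 S
    distinct : Distinct S
    above    : Above b S

Good-keep : ∀ b {T} → Good 0 T → Good b (keep b T)
Good-keep b {T} (good ok d _) = good (keep-Admissible b ok) (AllPairsₚ.filter⁺ _ d) (Allₚ.all-filter (λ e → b <ₐ? proj₂ e) T)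

Good-ins : ∀ {b S T} → Good (suc b) S → T ∈ ins (false , suc b) S → Good b T
Good-ins {S = S} (good ok d ab) T∈ = good (Ins-Admissible-false ok i) (Ins-Distinct ab d i)
  (Ins-All ℕₚ.≤-refl (All.map ℕₚ.<⇒≤ ab) i)
  where i = ins⁻ S T∈

Good-attach : ∀ {b S T} → Good (suc b) S → T ∈ S ∷ attach (suc b) S → Good b T
Good-attach (good ok d ab) (here refl) = good ok d (All.map ℕₚ.<⇒≤ ab)
Good-attach {S = S} (good ok d ab) (there T∈) = good (attach-Admissible ab ok T∈) (Ins-Distinct ab d i)
  (Ins-All ℕₚ.≤-refl (All.map ℕₚ.<⇒≤ ab) i)
  where i = attach⁻ S T∈

keep-attach : ∀ {b S T} → Above b S → T ∈ S ∷ attach b S → keep b T ≡ S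
keep-attach ab (here refl) = keep-above ab
keep-attach {S = S} ab (there T∈) = keep-Ins ab (attach⁻ S T∈)

cost-attach : ∀ {b} S {T} → T ∈ S ∷ attach b S → cost T ≡ cost S
cost-attach S (here refl) = refl
cost-attach S (there T∈)  = cost-Ins-true (attach⁻ S T∈)

blocks-attach : ∀ {b} S {T} → T ∈ S ∷ attach b S → blocks T ≡ blocks S
blocks-attach S (here refl) = refl
blocks-attach S (there T∈)  = blocks-Ins-true (attach⁻ S T∈)

module _ {A B : Set} where

  length-concatMap : ∀ {k} (f : A → List B) xs → (∀ {x} → x ∈ xs → length (f x) ≡ k) →
                     length (concatMap f xs) ≡ length xs ℕ.* k
  length-concatMap f []       eq = refl
  length-concatMap f (x ∷ xs) eq = trans (Listₚ.length-++ (f x))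
    (cong₂ _+_ (eq (here refl)) (length-concatMap f xs (eq ∘ there)))

  ∈-concatMap⁻′ : ∀ (f : A → List B) xs {y} → y ∈ concatMap f xs → ∃ λ x → x ∈ xs × y ∈ f x
  ∈-concatMap⁻′ f xs y∈ = find (∈ₚ.∈-concatMap⁻ f {xs = xs} y∈)

  ∈-concatMap⁺′ : ∀ (f : A → List B) {x xs y} → x ∈ xs → y ∈ f x → y ∈ concatMap f xs
  ∈-concatMap⁺′ f x∈ y∈ = ∈ₚ.∈-concatMap⁺ f (lose x∈ y∈)

  -- The key recovers from an element the `x` whose list it came from, so the lists of different `x`
  -- are disjoint. For paths the key is `keep b`.
  Unique-concatMap : ∀ (f : A → List B) (key : B → A) {xs} → Unique xs →
                     (∀ {x} → x ∈ xs → Unique (f x)) → (∀ {x y} → x ∈ xs → y ∈ f x → key y ≡ x) →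
                     Unique (concatMap f xs)
  Unique-concatMap f key [] uf kf = []
  Unique-concatMap f key {x ∷ xs} (x∉ ∷ u) uf kf =
    Uniqueₚ.++⁺ (uf (here refl)) (Unique-concatMap f key u (uf ∘ there) (λ z∈ → kf (there z∈))) disjoint
    where
    disjoint : ∀ {y} → ¬ (y ∈ f x × y ∈ concatMap f xs)
    disjoint (y∈ , y∈′) with ∈-concatMap⁻′ f xs y∈′
    ... | z , z∈ , y∈fz = All.lookup x∉ z∈ (trans (sym (kf (here refl) y∈)) (kf (there z∈) y∈fz))

-- `S ∷ attach (suc b) S` and `ins (false , suc b) S` both have `suc (blocks S)` members. How many
-- placements follow depends only on the number of blocks, not on the member chosen.
length-extensions : ∀ b {S} m → Good b S → length (extensions b S m) ≡ placements b (blocks S) m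
length-extensions zero    zero    g = refl
length-extensions zero    (suc m) g = refl
length-extensions (suc b) {S} m g with suc b ≤? m
... | no  _ = trans (length-concatMap (λ T → extensions b T m) (S ∷ attach (suc b) S) each)
                    (cong (λ l → suc l ℕ.* placements b (blocks S) m) (length-attach (suc b) (Good.ok g)))
  where
  each : ∀ {T} → T ∈ S ∷ attach (suc b) S → length (extensions b T m) ≡ placements b (blocks S) m
  each T∈ = trans (length-extensions b m (Good-attach g T∈)) (cong (λ t → placements b t m) (blocks-attach S T∈))
... | yes _ = trans (Listₚ.length-++ (concatMap (λ T → extensions b T m) (S ∷ attach (suc b) S)))
  (cong₂ _+_
    (trans (length-concatMap (λ T → extensions b T m) (S ∷ attach (suc b) S) each)
           (cong (λ l → suc l ℕ.* placements b (blocks S) m) (length-attach (suc b) (Good.ok g))))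
    (trans (length-concatMap (λ T → extensions b T (m ∸ suc b)) (ins (false , suc b) S) each′)
           (cong (ℕ._* placements b (suc (blocks S)) (m ∸ suc b)) (length-ins (false , suc b) S))))
  where
  each : ∀ {T} → T ∈ S ∷ attach (suc b) S → length (extensions b T m) ≡ placements b (blocks S) m
  each T∈ = trans (length-extensions b m (Good-attach g T∈)) (cong (λ t → placements b t m) (blocks-attach S T∈))
  each′ : ∀ {T} → T ∈ ins (false , suc b) S → length (extensions b T (m ∸ suc b)) ≡ placements b (suc (blocks S)) (m ∸ suc b)
  each′ T∈ = trans (length-extensions b (m ∸ suc b) (Good-ins g T∈))
                   (cong (λ t → placements b t (m ∸ suc b)) (blocks-Ins-false (ins⁻ S T∈)))

record Extends (b : ℕ) (S : Path) (m : ℕ) (T : Path) : Set where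
  constructor extends
  field
    good₀  : Good 0 T
    cost≡  : cost T ≡ cost S + m
    keep≡  : keep b T ≡ S

extensions⁻ : ∀ b {S} m {T} → Good b S → T ∈ extensions b S m → Extends b S m T
extensions⁻ zero {S} zero g (here refl) = extends g (sym (ℕₚ.+-identityʳ _)) (keep-above (Good.above g))
extensions⁻ (suc b) {S} m {T} g T∈ with suc b ≤? m
... | no  _ = skipped T∈
  where
  skipped : T ∈ concatMap (λ T → extensions b T m) (S ∷ attach (suc b) S) → Extends (suc b) S m T
  skipped T∈ with ∈-concatMap⁻′ (λ T → extensions b T m) (S ∷ attach (suc b) S) T∈
  ... | S′ , S′∈ , T∈′ with extensions⁻ b m (Good-attach g S′∈) T∈′
  ... | extends g′ c≡ refl = extends g′ (trans c≡ (cong (_+ m) (cost-attach S S′∈)))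
        (trans (sym (keep-keep (ℕₚ.n≤1+n b) T)) (keep-attach (Good.above g) S′∈))
... | yes b<m with ∈ₚ.∈-++⁻ (concatMap (λ T → extensions b T m) (S ∷ attach (suc b) S)) T∈
...   | inj₁ T∈ˡ with ∈-concatMap⁻′ (λ T → extensions b T m) (S ∷ attach (suc b) S) T∈ˡ
...     | S′ , S′∈ , T∈′ with extensions⁻ b m (Good-attach g S′∈) T∈′
...       | extends g′ c≡ refl = extends g′ (trans c≡ (cong (_+ m) (cost-attach S S′∈)))
        (trans (sym (keep-keep (ℕₚ.n≤1+n b) T)) (keep-attach (Good.above g) S′∈))
extensions⁻ (suc b) {S} m {T} g T∈ | yes b<m | inj₂ T∈ʳ
  with ∈-concatMap⁻′ (λ T → extensions b T (m ∸ suc b)) (ins (false , suc b) S) T∈ʳ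
... | S′ , S′∈ , T∈′ with extensions⁻ b (m ∸ suc b) (Good-ins g S′∈) T∈′
... | extends g′ c≡ refl = extends g′
    (trans c≡ (trans (cong (_+ (m ∸ suc b)) (cost-Ins-false i))
      (trans (ℕₚ.+-assoc (cost S) (suc b) _) (cong (cost S ℕ.+_) (ℕₚ.m+[n∸m]≡n b<m)))))
    (trans (sym (keep-keep (ℕₚ.n≤1+n b) T)) (keep-Ins (Good.above g) i))
    where i = ins⁻ S S′∈

-- `suc b` is the least value that can occur in `U`, and it occurs at most once. If it does,
-- everything after it is larger, hence free.
keep-or-Ins : ∀ {b p U} → Admissible p U → Distinct U → Above b U →
              U ≡ keep (suc b) U ⊎ ∃ λ f → Ins (f , suc b) (keep (suc b) U) U
keep-or-Ins [] [] [] = inj₁ refl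
keep-or-Ins {b} {U = (f , x) ∷ V} ok (n ∷ d) (a ∷ ab) with suc b <ₐ? x
... | no ¬lt with ℕₚ.≤-antisym (ℕₚ.≮⇒≥ ¬lt) a
...   | refl = inj₂ (f , subst (λ W → Ins (f , suc b) W ((f , suc b) ∷ V)) (sym (keep-above ab′)) (here (Admissible-above⇒Free (tail-Admissible ok) ab′)))
  where
  ab′ : Above (suc b) V
  ab′ = All.zipWith (λ (b<y , y≢) → ℕₚ.≤∧≢⇒< b<y y≢) (ab , n)
keep-or-Ins {b} {U = (f , x) ∷ V} ok (n ∷ d) (a ∷ ab) | yes lt with keep-or-Ins (tail-Admissible ok) d ab
... | inj₁ eq      = inj₁ (cong (_ ∷_) eq)
... | inj₂ (f , i) = inj₂ (f , there i)

-- The history of `T` is read off from `T` itself: `keep b T` differs from `keep (suc b) T` by at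
-- most one insertion, and the flag of the inserted entry tells which branch of `extensions` made
-- it.
extensions⁺ : ∀ b {T} m → Good 0 T → cost T ≡ cost (keep b T) + m → T ∈ extensions b (keep b T) m
extensions⁺ zero {T} m g c≡ with keep 0 T | keep-above (Good.above g)
... | _ | refl with ℕₚ.+-cancelˡ-≡ (cost T) 0 m (trans (ℕₚ.+-identityʳ _) c≡)
...   | refl = here refl
extensions⁺ (suc b) {T} m g c≡ with suc b ≤? m | next
  where
  gU = Good-keep b g
  next : (keep b T ∈ keep (suc b) T ∷ attach (suc b) (keep (suc b) T)) ⊎ Ins (false , suc b) (keep (suc b) T) (keep b T)
  next with keep-or-Ins (Good.ok gU) (Good.distinct gU) (Good.above gU)
  ... | inj₁ eq          = inj₁ (here (trans eq (keep-keep (ℕₚ.n≤1+n b) T)))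
  ... | inj₂ (true  , i) = inj₁ (there (attach⁺ (Good.ok gU) (subst (λ R → Ins _ R (keep b T)) (keep-keep (ℕₚ.n≤1+n b) T) i)))
  ... | inj₂ (false , i) = inj₂ (subst (λ R → Ins _ R (keep b T)) (keep-keep (ℕₚ.n≤1+n b) T) i)
... | yes b<m | inj₂ i = ∈ₚ.∈-++⁺ʳ _ (∈-concatMap⁺′ (λ T → extensions b T (m ∸ suc b)) (ins⁺ i)
  (extensions⁺ b (m ∸ suc b) g (trans c≡ (trans (cong (cost (keep (suc b) T) ℕ.+_) (sym (ℕₚ.m+[n∸m]≡n b<m)))
    (trans (sym (ℕₚ.+-assoc (cost (keep (suc b) T)) (suc b) _)) (cong (_+ (m ∸ suc b)) (sym (cost-Ins-false i))))))))
-- Opening the block adds `suc b` to the cost, and the values placed later cannot lower it, so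
-- `suc b` is at most `m`.
... | no ¬b<m | inj₂ i = ⊥-elim (¬b<m (ℕₚ.+-cancelˡ-≤ (cost (keep (suc b) T)) (suc b) m
  (subst₂ _≤_ (cost-Ins-false i) c≡ (cost-keep b T))))
... | yes _ | inj₁ U∈ = ∈ₚ.∈-++⁺ˡ (∈-concatMap⁺′ (λ T → extensions b T m) U∈
  (extensions⁺ b m g (trans c≡ (cong (_+ m) (sym (cost-attach (keep (suc b) T) U∈))))))
... | no _ | inj₁ U∈ = ∈-concatMap⁺′ (λ T → extensions b T m) U∈
  (extensions⁺ b m g (trans c≡ (cong (_+ m) (sym (cost-attach (keep (suc b) T) U∈)))))

Unique-ins : ∀ {f x} S → Above x S → Unique (ins (f , x) S)
Unique-ins []                ab       = [] ∷ []
Unique-ins {f} {x} ((false , y) ∷ v) (a ∷ ab) =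
  All.tabulate new ∷ Uniqueₚ.map⁺ Listₚ.∷-injectiveʳ (Unique-ins v ab)
  where
  new : ∀ {T} → T ∈ map ((false , y) ∷_) (ins (f , x) v) → (f , x) ∷ (false , y) ∷ v ≢ T
  new T∈ eq with ∈ₚ.∈-map⁻ _ T∈
  ... | w , w∈ , refl = ℕₚ.<⇒≢ a (cong proj₂ (Listₚ.∷-injectiveˡ eq))
Unique-ins ((true , y) ∷ v) (a ∷ ab) = Uniqueₚ.map⁺ Listₚ.∷-injectiveʳ (Unique-ins v ab)

Unique-attach : ∀ {x} S → Above x S → Unique (S ∷ attach x S)
Unique-attach [] ab = [] ∷ []
Unique-attach S@(y ∷ v) (a ∷ ab) =
  All.tabulate (λ T∈ eq → Ins-irrefl (subst (Ins _ S) (sym eq) (attach⁻ S T∈))) ∷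
  Uniqueₚ.map⁺ Listₚ.∷-injectiveʳ (Unique-ins v ab)

Unique-extensions : ∀ b {S} m → Good b S → Unique (extensions b S m)
Unique-extensions zero    zero    g = [] ∷ []
Unique-extensions zero    (suc m) g = []
Unique-extensions (suc b) {S} m g with suc b ≤? m
... | no _ = Unique-concatMap _ (keep b) (Unique-attach S (Good.above g))
      (λ S′∈ → Unique-extensions b m (Good-attach g S′∈))
      (λ S′∈ T∈ → Extends.keep≡ (extensions⁻ b m (Good-attach g S′∈) T∈))
... | yes _ = Uniqueₚ.++⁺
      (Unique-concatMap _ (keep b) (Unique-attach S (Good.above g))
        (λ S′∈ → Unique-extensions b m (Good-attach g S′∈)) keyˡ)
      (Unique-concatMap _ (keep b) (Unique-ins S (Good.above g))
        (λ S′∈ → Unique-extensions b _ (Good-ins g S′∈)) keyʳ)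
      disjoint
  where
  keyˡ : ∀ {S′ T} → S′ ∈ S ∷ attach (suc b) S → T ∈ extensions b S′ m → keep b T ≡ S′
  keyˡ S′∈ T∈ = Extends.keep≡ (extensions⁻ b m (Good-attach g S′∈) T∈)
  keyʳ : ∀ {S′ T} → S′ ∈ ins (false , suc b) S → T ∈ extensions b S′ (m ∸ suc b) → keep b T ≡ S′
  keyʳ S′∈ T∈ = Extends.keep≡ (extensions⁻ b _ (Good-ins g S′∈) T∈)
  -- Both intermediate paths would equal `keep b T`, but only one of them has a block more than `S`.
  disjoint : ∀ {T} → ¬ (T ∈ concatMap (λ T → extensions b T m) (S ∷ attach (suc b) S) ×
                        T ∈ concatMap (λ T → extensions b T (m ∸ suc b)) (ins (false , suc b) S))
  disjoint (T∈ˡ , T∈ʳ)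
    with ∈-concatMap⁻′ (λ T → extensions b T m) (S ∷ attach (suc b) S) T∈ˡ
       | ∈-concatMap⁻′ (λ T → extensions b T (m ∸ suc b)) (ins (false , suc b) S) T∈ʳ
  ... | S₁ , S₁∈ , T∈₁ | S₂ , S₂∈ , T∈₂ = ℕₚ.1+n≢n (begin
    suc (blocks S) ≡⟨ blocks-Ins-false (ins⁻ S S₂∈) ⟨
    blocks S₂      ≡⟨ cong blocks (trans (sym (keyʳ S₂∈ T∈₂)) (keyˡ S₁∈ T∈₁)) ⟩
    blocks S₁      ≡⟨ blocks-attach S S₁∈ ⟩
    blocks S       ∎)

-- States and traces

-- With this recursion, lowering both arguments by one holds by definition; so `⟶-fall` is plain
-- reflexivity.
δ : ℕ → ℕ → ℕ
δ zero    zero    = 1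
δ zero    (suc i) = 0
δ (suc a) zero    = 0
δ (suc a) (suc i) = δ a i

δ-refl : ∀ a → δ a a ≡ 1
δ-refl zero    = refl
δ-refl (suc a) = δ-refl a

δ≤1 : ∀ a i → δ a i ≤ 1
δ≤1 zero    zero    = s≤s z≤n
δ≤1 zero    (suc i) = z≤n
δ≤1 (suc a) zero    = z≤n
δ≤1 (suc a) (suc i) = δ≤1 a i

1≤δ⇒≡ : ∀ {a i} → 1 ≤ δ a i → a ≡ i
1≤δ⇒≡ {zero}  {zero}  _ = refl
1≤δ⇒≡ {suc a} {suc i} h = cong suc (1≤δ⇒≡ h)

δ-beyond : ∀ {a i} → a < i → δ a i ≡ 0
δ-beyond {zero}  {suc i} _         = refl
δ-beyond {suc a} {suc i} (s≤s a<i) = δ-beyond a<i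

Gap : Set
Gap = ℕ × ℕ

-- (a , d) stands for the state with balls at heights a and a + d.
occ : Gap → ℕ → ℕ
occ (a , d) i = δ a i + δ (a + d) i

sum-applyUpTo-+ : ∀ (f g : ℕ → ℕ) n → sum (applyUpTo (λ i → f i + g i) n) ≡ sum (applyUpTo f n) + sum (applyUpTo g n)
sum-applyUpTo-+ f g zero    = refl
sum-applyUpTo-+ f g (suc n) = trans (cong (f 0 + g 0 ℕ.+_) (sum-applyUpTo-+ (f ∘ suc) (g ∘ suc) n))
                                    (ℕ-interchange (f 0) (g 0) _ _)
  where open import Algebra.Properties.CommutativeSemigroup ℕₚ.+-commutativeSemigroup renaming (interchange to ℕ-interchange)

sum-0 : ∀ n → sum (applyUpTo (λ _ → 0) n) ≡ 0
sum-0 zero    = refl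
sum-0 (suc n) = sum-0 n

sum-δ : ∀ {a n} → a < n → sum (applyUpTo (δ a) n) ≡ 1
sum-δ {zero}  {suc n} _         = cong suc (sum-0 n)
sum-δ {suc a} {suc n} (s≤s a<n) = sum-δ a<n

toState : Gap → State
toState x@(a , d) = record
  { α       = occ x
  ; entries = λ i → ℕₚ.+-mono-≤ (δ≤1 a i) (δ≤1 (a + d) i)
  ; support = suc (a + d)
            , (λ i N≤i → cong₂ _+_ (δ-beyond (ℕₚ.≤-<-trans (ℕₚ.m≤m+n a d) N≤i)) (δ-beyond N≤i))
            , (begin
                sum (map (occ x) (upTo (suc (a + d))))   ≡⟨ cong sum (Listₚ.map-upTo (occ x) (suc (a + d))) ⟩
                sum (applyUpTo (occ x) (suc (a + d)))    ≡⟨ sum-applyUpTo-+ (δ a) (δ (a + d)) (suc (a + d)) ⟩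
                sum (applyUpTo (δ a) (suc (a + d))) + sum (applyUpTo (δ (a + d)) (suc (a + d)))
                                                         ≡⟨ cong₂ _+_ (sum-δ (s≤s (ℕₚ.m≤m+n a d))) (sum-δ {a + d} ℕₚ.≤-refl) ⟩
                2                                        ∎)
  }

sum≡0⇒ : ∀ (f : ℕ → ℕ) N → (∀ i → N ≤ i → f i ≡ 0) → sum (applyUpTo f N) ≡ 0 → ∀ i → f i ≡ 0
sum≡0⇒ f zero    beyond _  i       = beyond i z≤n
sum≡0⇒ f (suc N) beyond s≡ zero    = ℕₚ.m+n≡0⇒m≡0 (f 0) s≡
sum≡0⇒ f (suc N) beyond s≡ (suc i) = sum≡0⇒ (f ∘ suc) N (λ i N≤i → beyond (suc i) (s≤s N≤i)) (ℕₚ.m+n≡0⇒n≡0 (f 0) s≡) i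

sum≡1⇒ : ∀ (f : ℕ → ℕ) N → (∀ i → N ≤ i → f i ≡ 0) → sum (applyUpTo f N) ≡ 1 → ∃ λ a → ∀ i → f i ≡ δ a i
sum≡1⇒ f (suc N) beyond s≡ with f 0 in f0
... | suc k = 0 , λ { zero → trans f0 (cong suc (ℕₚ.m+n≡0⇒m≡0 k (ℕₚ.suc-injective s≡)))
                    ; (suc i) → sum≡0⇒ (f ∘ suc) N (λ i N≤i → beyond (suc i) (s≤s N≤i))
                                  (ℕₚ.m+n≡0⇒n≡0 k (ℕₚ.suc-injective s≡)) i }
... | zero with sum≡1⇒ (f ∘ suc) N (λ i N≤i → beyond (suc i) (s≤s N≤i)) s≡
...   | a , eq = suc a , λ { zero → f0 ; (suc i) → eq i }

sum≡2⇒ : ∀ (f : ℕ → ℕ) N → (∀ i → N ≤ i → f i ≡ 0) → sum (applyUpTo f N) ≡ 2 → ∃ λ x → ∀ i → f i ≡ occ x i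
sum≡2⇒ f (suc N) beyond s≡ with f 0 in f0
... | zero with sum≡2⇒ (f ∘ suc) N (λ i N≤i → beyond (suc i) (s≤s N≤i)) s≡
...   | (a , d) , eq = (suc a , d) , λ { zero → f0 ; (suc i) → eq i }
sum≡2⇒ f (suc N) beyond s≡ | suc zero with sum≡1⇒ (f ∘ suc) N (λ i N≤i → beyond (suc i) (s≤s N≤i)) (ℕₚ.suc-injective s≡)
...   | b , eq = (0 , suc b) , λ { zero → f0 ; (suc i) → eq i }
sum≡2⇒ f (suc N) beyond s≡ | suc (suc k) = (0 , 0) ,
  λ { zero → trans f0 (cong (2 ℕ.+_) (ℕₚ.m+n≡0⇒m≡0 k rest≡0))
    ; (suc i) → sum≡0⇒ (f ∘ suc) N (λ i N≤i → beyond (suc i) (s≤s N≤i)) (ℕₚ.m+n≡0⇒n≡0 k rest≡0) i }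
  where rest≡0 = ℕₚ.suc-injective (ℕₚ.suc-injective s≡)

decode : (s : State) → ∃ λ x → ∀ i → α s i ≡ occ x i
decode s with support s
... | N , beyond , s≡ = sum≡2⇒ (α s) N beyond (trans (cong sum (sym (Listₚ.map-upTo (α s) N))) s≡)

-- Both sides hold two balls in all, so domination leaves no room for a difference.
occ-≤⇒≡ : ∀ x y → (∀ i → occ x i ≤ occ y i) → x ≡ y
occ-≤⇒≡ (zero , d) (zero , d′) h =
  cong (0 ,_) (sym (1≤δ⇒≡ (subst (_≤ δ d′ d) (δ-refl d) (ℕₚ.+-cancelˡ-≤ (δ 0 d) _ _ (h d)))))
occ-≤⇒≡ (zero , d) (suc a′ , d′) h with () ← h 0
occ-≤⇒≡ (suc a , d) (suc a′ , d′) h with occ-≤⇒≡ (a , d) (a′ , d′) (h ∘ suc)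
... | refl = refl
-- One ball of the second state is at height 0, where the first has none. Both balls of the first
-- would have to share the place of the remaining ball, giving 2 ≤ 1.
occ-≤⇒≡ (suc a , d) (zero , d′) h
  with 1≤δ⇒≡ {d′} {suc a} (ℕₚ.≤-trans (subst (1 ≤_) (cong (_+ δ (a + d) a) (sym (δ-refl a))) (s≤s z≤n)) (h (suc a)))
... | refl with 1≤δ⇒≡ {a} {a + d} (ℕₚ.≤-trans (subst (1 ≤_) (trans (ℕₚ.+-comm 1 _) (cong (δ a (a + d) ℕ.+_) (sym (δ-refl (a + d))))) (s≤s z≤n)) (h (suc (a + d))))
...   | a≡a+d = ⊥-elim (ℕₚ.<-irrefl refl (ℕₚ.≤-trans (subst (2 ≤_) two ℕₚ.≤-refl) (ℕₚ.≤-trans (h (suc a)) (δ≤1 a a))))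
  where
  two : 2 ≡ δ a a + δ (a + d) a
  two = sym (cong₂ _+_ (δ-refl a) (trans (cong (λ z → δ z a) (sym a≡a+d)) (δ-refl a)))

-- Transitions, falls and traces

record _⟶_ (x y : Gap) : Set where
  constructor arrow
  field occ-≤ : ∀ i → occ x (suc i) ≤ occ y i
open _⟶_

⟶-fall : ∀ {a d} → (suc a , d) ⟶ (a , d)
⟶-fall = arrow λ i → ℕₚ.≤-refl

⟶-restart : ∀ {y} → (0 , 0) ⟶ y
⟶-restart = arrow λ i → z≤n

-- The ball that is not thrown falls to `d`. The thrown ball lands at distance `d′` above it here,
-- and below it in `⟶-under`.
⟶-over : ∀ {d d′} → (0 , suc d) ⟶ (d , d′)
⟶-over = arrow λ i → ℕₚ.m≤m+n _ _

⟶-under : ∀ {a e} → (0 , suc (a + e)) ⟶ (a , e)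
⟶-under {a} {e} = arrow λ i → ℕₚ.m≤n+m _ (δ a i)

fall-unique : ∀ {a d y} → (suc a , d) ⟶ y → y ≡ (a , d)
fall-unique {a} {d} {y} (arrow h) = sym (occ-≤⇒≡ (a , d) y h)

-- The ball falling to `d` is the lower or the upper one of the next state. Balls at equal height
-- are counted in the first case, so that the second provides `0 < e`.
⟶-throw : ∀ {d a e} → (0 , suc d) ⟶ (a , e) → d ≡ a ⊎ (0 < e × d ≡ a + e)
⟶-throw {d} {a} {e} (arrow h) with δ a d in eq
... | suc _ = inj₁ (sym (1≤δ⇒≡ (subst (1 ≤_) (sym eq) (s≤s z≤n))))
... | zero with 1≤δ⇒≡ {a + e} {d} (subst₂ _≤_ (δ-refl d) (cong (_+ δ (a + e) d) eq) (h d))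
...   | refl with e
...     | zero  = inj₁ (ℕₚ.+-identityʳ a)
...     | suc e = inj₂ (s≤s z≤n , refl)

fall : ℕ → ℕ → List Gap
fall zero    d = (0 , d) ∷ []
fall (suc a) d = (suc a , d) ∷ fall a d

-- The height of the lower ball right after a throw from the state {0,p} to distance e.
landing : Bool → ℕ → ℕ → ℕ
landing false p e = p ∸ 1
landing true  p e = p ∸ suc e

-- The states following {0,p}.  Since {0, a+1} and {0,0} can both be followed by (a , d), a whole cycle
-- starting from {0,0} with first landing height a is the trace with p = a + 1.
trace : ℕ → Path → List Gap
trace p []            = fall (p ∸ 1) 0
trace p ((f , e) ∷ P) = fall (landing f p e) e ++ trace e P

data Chain : Gap → List Gap → Gap → Set where
  []  : ∀ {x} → Chain x [] x
  _∷_ : ∀ {x y z w} → x ⟶ y → Chain y w z → Chain x (y ∷ w) z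

Chain-++ : ∀ {x y z v w} → Chain x v y → Chain y w z → Chain x (v ++ w) z
Chain-++ []      d = d
Chain-++ (t ∷ c) d = t ∷ Chain-++ c d

Chain-fall : ∀ {x} a {d} → x ⟶ (a , d) → Chain x (fall a d) (0 , d)
Chain-fall zero    t = t ∷ []
Chain-fall (suc a) t = t ∷ Chain-fall a ⟶-fall

Chain-trace : ∀ {p P} → 0 < p → Admissible p P → Above 0 P → Chain (0 , p) (trace p P) (0 , 0)
Chain-trace {suc p} _ [] [] = Chain-fall p ⟶-over
Chain-trace {suc p} _ (attached {x = e} (s≤s e≤p) ok) (e>0 ∷ ab) =
  Chain-++ (Chain-fall (p ∸ e) (subst (λ q → (0 , suc q) ⟶ (p ∸ e , e)) (ℕₚ.m∸n+n≡m e≤p) (⟶-under {p ∸ e})))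
           (Chain-trace e>0 ok ab)
Chain-trace {suc p} _ (jump ok) (e>0 ∷ ab) = Chain-++ (Chain-fall p ⟶-over) (Chain-trace e>0 ok ab)

Chain-restart : ∀ {x w} → Chain x w (0 , 0) → Chain (0 , 0) w (0 , 0)
Chain-restart []      = []
Chain-restart (_ ∷ c) = ⟶-restart ∷ c

length-fall : ∀ a d → length (fall a d) ≡ suc a
length-fall zero    d = refl
length-fall (suc a) d = cong suc (length-fall a d)

-- Attaching `e` shortens the current fall by `e` states, which exactly pays for the `e` beats the
-- next step takes; hence attached entries add nothing to `cost`.
length-trace : ∀ {p P} → 0 < p → Admissible p P → Above 0 P → length (trace p P) ≡ p + cost P
length-trace {suc p} _ [] [] = trans (length-fall p 0) (sym (ℕₚ.+-identityʳ (suc p)))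
length-trace {suc p} _ (attached {x = e} {P} (s≤s e≤p) ok) (e>0 ∷ ab) = begin
  length (fall (p ∸ e) e ++ trace e P) ≡⟨ Listₚ.length-++ (fall (p ∸ e) e) ⟩
  length (fall (p ∸ e) e) + length (trace e P) ≡⟨ cong₂ _+_ (length-fall (p ∸ e) e) (length-trace e>0 ok ab) ⟩
  suc (p ∸ e) + (e + cost P) ≡⟨ ℕₚ.+-assoc (suc (p ∸ e)) e (cost P) ⟨
  suc (p ∸ e + e) + cost P   ≡⟨ cong (λ q → suc q + cost P) (ℕₚ.m∸n+n≡m e≤p) ⟩
  suc p + cost P ∎
length-trace {suc p} _ (jump {x = e} {P} ok) (e>0 ∷ ab) = begin
  length (fall p e ++ trace e P) ≡⟨ Listₚ.length-++ (fall p e) ⟩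
  length (fall p e) + length (trace e P) ≡⟨ cong₂ _+_ (length-fall p e) (length-trace e>0 ok ab) ⟩
  suc p + (e + cost P) ∎

All-fall : ∀ {Q : ℕ → Set} a {d} → Q d → All (Q ∘ proj₂) (fall a d)
All-fall zero    q = q ∷ []
All-fall (suc a) q = q ∷ All-fall a q

All-trace : ∀ {Q : ℕ → Set} {p} P → Q 0 → All (Q ∘ proj₂) P → All (Q ∘ proj₂) (trace p P)
All-trace {p = p} [] q0 [] = All-fall (p ∸ 1) q0
All-trace {p = p} ((f , e) ∷ P) q0 (q ∷ qs) = Allₚ.++⁺ (All-fall (landing f p e) q) (All-trace P q0 qs)

fall-below : ∀ a d → All (λ x → proj₁ x ≤ a) (fall a d)
fall-below zero    d = z≤n ∷ []
fall-below (suc a) d = ℕₚ.≤-refl ∷ All.map ℕₚ.m≤n⇒m≤1+n (fall-below a d)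

Unique-fall : ∀ a d → Unique (fall a d)
Unique-fall zero    d = [] ∷ []
Unique-fall (suc a) d = All.map (λ x≤a eq → ℕₚ.1+n≰n (subst (_≤ a) (sym (cong proj₁ eq)) x≤a)) (fall-below a d) ∷ Unique-fall a d

-- States of different falls differ in their distance: the entries are distinct, and positive in
-- contrast to the final distance 0.
Unique-trace : ∀ {p P} → Above 0 P → Distinct P → Unique (trace p P)
Unique-trace {p} {[]} _ _ = Unique-fall (p ∸ 1) 0
Unique-trace {p} {(f , e) ∷ P} (e>0 ∷ ab) (e∉ ∷ d) =
  Uniqueₚ.++⁺ (Unique-fall (landing f p e) e) (Unique-trace ab d)
    (λ (x∈ , x∈′) → All.lookup (All-trace {Q = e ≢_} P (ℕₚ.>⇒≢ e>0) e∉) x∈′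
                      (sym (All.lookup (All-fall {Q = _≡ e} (landing f p e) refl) x∈)))

∈-fall : ∀ a d → (0 , d) ∈ fall a d
∈-fall zero    d = here refl
∈-fall (suc a) d = there (∈-fall a d)

∈-trace : ∀ {p} P → All (λ e → (0 , proj₂ e) ∈ trace p P) P
∈-trace []            = []
∈-trace {p} ((f , e) ∷ P) = ∈ₚ.∈-++⁺ˡ (∈-fall (landing f p e) e) ∷ All.map (∈ₚ.∈-++⁺ʳ _) (∈-trace P)

-- Junk value (0 , 0) beyond the end of the list.
nth : List Gap → ℕ → Gap
nth []      _       = 0 , 0
nth (x ∷ w) zero    = x
nth (x ∷ w) (suc i) = nth w i

nth-fall : ∀ a {d} w → nth (fall a d ++ w) 0 ≡ (a , d)
nth-fall zero    w = refl
nth-fall (suc a) w = refl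

nth-fall′ : ∀ a {d} → nth (fall a d) 0 ≡ (a , d)
nth-fall′ zero    = refl
nth-fall′ (suc a) = refl

nth-∈ : ∀ {w i} → i < length w → nth w i ∈ w
nth-∈ {x ∷ w} {zero}  _         = here refl
nth-∈ {x ∷ w} {suc i} (s≤s i<n) = there (nth-∈ i<n)

nth-injective : ∀ {w i j} → Unique w → i < length w → j < length w → nth w i ≡ nth w j → i ≡ j
nth-injective {x ∷ w} {zero}  {zero}  _       _         _         _  = refl
nth-injective {x ∷ w} {zero}  {suc j} (n ∷ u) _         (s≤s j<n) eq = ⊥-elim (All.lookup n (nth-∈ j<n) eq)
nth-injective {x ∷ w} {suc i} {zero}  (n ∷ u) (s≤s i<n) _         eq = ⊥-elim (All.lookup n (nth-∈ i<n) (sym eq))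
nth-injective {x ∷ w} {suc i} {suc j} (n ∷ u) (s≤s i<n) (s≤s j<n) eq = cong suc (nth-injective u i<n j<n eq)

nth-ext : ∀ v w → length v ≡ length w → (∀ i → i < length v → nth v i ≡ nth w i) → v ≡ w
nth-ext []      []      _   _  = refl
nth-ext (x ∷ v) (y ∷ w) len eq = cong₂ _∷_ (eq 0 (s≤s z≤n))
  (nth-ext v w (ℕₚ.suc-injective len) (λ i i<n → eq (suc i) (s≤s i<n)))

nth-applyUpTo : ∀ (f : ℕ → Gap) {n i} → i < n → nth (applyUpTo f n) i ≡ f i
nth-applyUpTo f {suc n} {zero}  _         = refl
nth-applyUpTo f {suc n} {suc i} (s≤s i<n) = nth-applyUpTo (f ∘ suc) i<n

nth-⟶ : ∀ {x w z i} → Chain x w z → suc i < length w → nth w i ⟶ nth w (suc i)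
nth-⟶ {i = zero}  (_ ∷ [])      (s≤s ())
nth-⟶ {i = zero}  (_ ∷ (t ∷ c)) _         = t
nth-⟶ {i = suc i} (_ ∷ c)       (s≤s i<n) = nth-⟶ c i<n

nth-last : ∀ {x w z m} → Chain x w z → length w ≡ suc m → nth w m ≡ z
nth-last {m = zero}  (_ ∷ [])      _   = refl
nth-last {m = suc m} (_ ∷ (t ∷ c)) len = nth-last (t ∷ c) (ℕₚ.suc-injective len)

-- The first state of the trace shows the first distance and the landing height. As the distance is
-- positive, the two flags land at different heights, so the flag is determined too.
trace-injective : ∀ {p P P′} → 0 < p → Admissible p P → Admissible p P′ → Above 0 P → Above 0 P′ →
                  trace p P ≡ trace p P′ → P ≡ P′
trace-injective {p} {[]} {[]} _ _ _ _ _ _ = refl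
trace-injective {p} {[]} {(f , e) ∷ P′} _ _ _ _ (e>0 ∷ _) eq =
  ⊥-elim (ℕₚ.<⇒≢ e>0 (cong proj₂ (trans (sym (nth-fall′ (p ∸ 1))) (trans (cong (λ w → nth w 0) eq) (nth-fall (landing f p e) _)))))
trace-injective {p} {(f , e) ∷ P} {[]} _ _ _ (e>0 ∷ _) _ eq =
  ⊥-elim (ℕₚ.<⇒≢ e>0 (cong proj₂ (trans (sym (nth-fall′ (p ∸ 1))) (trans (cong (λ w → nth w 0) (sym eq)) (nth-fall (landing f p e) _)))))
trace-injective {suc p} {(f , e) ∷ P} {(f′ , e′) ∷ P′} 0<p ok ok′ (e>0 ∷ ab) (_ ∷ ab′) eq
  with trans (sym (nth-fall (landing f (suc p) e) _)) (trans (cong (λ w → nth w 0) eq) (nth-fall (landing f′ (suc p) e′) _))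
... | heads with cong proj₂ heads
...   | refl with flags ok ok′ (cong proj₁ heads)
  where
  flags : ∀ {f f′ P P′} → Admissible (suc p) ((f , e) ∷ P) → Admissible (suc p) ((f′ , e) ∷ P′) →
          landing f (suc p) e ≡ landing f′ (suc p) e → f ≡ f′
  flags (attached _ _)         (attached _ _)         _ = refl
  flags (jump _)          (jump _)          _ = refl
  flags (attached (s≤s e≤p) _) (jump _)          l = ⊥-elim (ℕₚ.<⇒≢ (ℕₚ.∸-monoʳ-< e>0 e≤p) l)
  flags (jump _)          (attached (s≤s e≤p) _) l = ⊥-elim (ℕₚ.<⇒≢ (ℕₚ.∸-monoʳ-< e>0 e≤p) (sym l))
...     | refl = cong ((f , e) ∷_) (trace-injective e>0 (tail-Admissible ok) (tail-Admissible ok′) ab ab′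
                   (Listₚ.++-cancelˡ (fall (landing f (suc p) e) e) _ _ eq))

-- Patterns

module _ {A : Set} (f : ℕ → A) (n : ℕ) .{{_ : ℕ.NonZero n}} (periodic : ∀ k → f (k + n) ≡ f k) where

  periodic-* : ∀ k q → f (k + q ℕ.* n) ≡ f k
  periodic-* k zero    = cong f (ℕₚ.+-identityʳ k)
  periodic-* k (suc q) = begin
    f (k + (n + q ℕ.* n)) ≡⟨ cong (λ x → f (k + x)) (ℕₚ.+-comm n (q ℕ.* n)) ⟩
    f (k + (q ℕ.* n + n)) ≡⟨ cong f (ℕₚ.+-assoc k (q ℕ.* n) n) ⟨
    f (k + q ℕ.* n + n)   ≡⟨ periodic (k + q ℕ.* n) ⟩
    f (k + q ℕ.* n)       ≡⟨ periodic-* k q ⟩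
    f k                   ∎

  periodic-% : ∀ k → f (k % n) ≡ f k
  periodic-% k = sym (trans (cong f (m≡m%n+[m/n]*n k n)) (periodic-* (k % n) (k ℕ./ n)))

-- n K is added on the left of both sides to cancel K modulo 1 + n.
%-cancelˡ : ∀ n K {k l} → k < suc n → l < suc n → (K + k) % suc n ≡ (K + l) % suc n → k ≡ l
%-cancelˡ n K {k} {l} k< l< eq = trans (sym (restore k<)) (trans (cong (λ x → (K ℕ.* n % suc n + x) % suc n) eq) (restore l<))
  where
  restore : ∀ {k} → k < suc n → (K ℕ.* n % suc n + (K + k) % suc n) % suc n ≡ k
  restore {k} k< = begin
    (K ℕ.* n % suc n + (K + k) % suc n) % suc n ≡⟨ %-distribˡ-+ (K ℕ.* n) (K + k) (suc n) ⟨
    (K ℕ.* n + (K + k)) % suc n                 ≡⟨ cong (_% suc n) (rearrange (K ℕ.* n) K k) ⟩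
    (k + (K + K ℕ.* n)) % suc n                 ≡⟨ cong (λ x → (k + x) % suc n) (ℕₚ.*-suc K n) ⟨
    (k + K ℕ.* suc n) % suc n                   ≡⟨ [m+kn]%n≡m%n k K (suc n) ⟩
    k % suc n                                   ≡⟨ m<n⇒m%n≡m k< ⟩
    k                                           ∎
    where
    rearrange : ∀ a b c → a + (b + c) ≡ c + (b + a)
    rearrange a b c = trans (ℕₚ.+-comm a (b + c)) (trans (cong (_+ a) (ℕₚ.+-comm b c)) (ℕₚ.+-assoc c b a))

applyUpTo-cong : ∀ {A : Set} {f g : ℕ → A} → (∀ k → f k ≡ g k) → ∀ n → applyUpTo f n ≡ applyUpTo g n
applyUpTo-cong eq zero    = refl
applyUpTo-cong eq (suc n) = cong₂ _∷_ (eq 0) (applyUpTo-cong (eq ∘ suc) n)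

applyUpTo-++ : ∀ {A : Set} (f : ℕ → A) b l → applyUpTo f (l + b) ≡ applyUpTo f b ++ applyUpTo (λ k → f (k + b)) l
applyUpTo-++ f zero    l = trans (cong (applyUpTo f) (ℕₚ.+-identityʳ l))
                                 (applyUpTo-cong (λ k → cong f (sym (ℕₚ.+-identityʳ k))) l)
applyUpTo-++ f (suc b) l = trans (cong (applyUpTo f) (ℕₚ.+-suc l b))
  (cong (f 0 ∷_) (trans (applyUpTo-++ (f ∘ suc) b l)
    (cong (applyUpTo (f ∘ suc) b ++_) (applyUpTo-cong (λ k → cong f (sym (ℕₚ.+-suc k b))) l))))

-- Walks ending at the only visit to the state {0,0}

Walk : (ℕ → Gap) → Set
Walk v = ∀ k → v k ⟶ v (suc k)

applyUpTo-fall : ∀ a {e} v → Walk v → v 0 ≡ (a , e) → applyUpTo v (suc a) ≡ fall a e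
applyUpTo-fall zero    v s v0 = cong (_∷ []) v0
applyUpTo-fall (suc a) v s v0 = cong₂ _∷_ v0
  (applyUpTo-fall a (v ∘ suc) (s ∘ suc) (fall-unique (subst (_⟶ v 1) v0 (s 0))))

land : ∀ a {e} v → Walk v → v 0 ≡ (a , e) → v a ≡ (0 , e)
land zero    v s v0 = v0
land (suc a) v s v0 = land a (v ∘ suc) (s ∘ suc) (fall-unique (subst (_⟶ v 1) v0 (s 0)))

airborne : ∀ {i} a {e} v → Walk v → v 0 ≡ (a , e) → i < a → v i ≢ (0 , 0)
airborne {zero}  (suc a) v s v0 _         eq with () ← trans (sym v0) eq
airborne {suc i} (suc a) v s v0 (s≤s i<a) eq =
  airborne a (v ∘ suc) (s ∘ suc) (fall-unique (subst (_⟶ v 1) v0 (s 0))) i<a eq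

record Traced (p m : ℕ) (v : ℕ → Gap) : Set where
  constructor traced
  field
    path     : Path
    ok       : Admissible p path
    above    : Above 0 path
    distinct : Distinct path
    trace≡   : applyUpTo v (suc m) ≡ trace p path

-- The walk is cut at its first landing `(0 , e)`. The remainder starts from `(0 , e)` and is
-- strictly shorter, which `fuel` makes structural.
walk⇒trace : ∀ fuel m → m < fuel → ∀ p v → (0 , suc p) ⟶ v 0 → Walk v → v m ≡ (0 , 0) →
             (∀ {k l} → k ≤ m → l ≤ m → v k ≡ v l → k ≡ l) → Traced (suc p) m v
walk⇒trace (suc fuel) m (s≤s m≤fuel) p v t s vm inj = go (proj₁ (v 0)) (proj₂ (v 0)) refl
  where
  module _ (a : ℕ) {e : ℕ} (v0 : v 0 ≡ (a , e)) where
    a≤m : a ≤ m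
    a≤m = ℕₚ.≮⇒≥ (λ m<a → airborne a v s v0 m<a vm)
    va : v a ≡ (0 , e)
    va = land a v s v0

  first : ∀ {a e} → v 0 ≡ (a , e) → p ≡ a ⊎ (0 < e × p ≡ a + e)
  first v0 = ⟶-throw (subst ((0 , suc p) ⟶_) v0 t)

  go : ∀ a e → v 0 ≡ (a , e) → Traced (suc p) m v
  -- The fall ends in `(0 , 0)` at time `a`, so `a` is `m` by injectivity and no entry follows.
  go a zero v0 with inj (a≤m a v0) ℕₚ.≤-refl (trans (va a v0) (sym vm)) | first v0
  ... | refl | inj₁ refl = traced [] [] [] [] (applyUpTo-fall a v s v0)
  go a e@(suc e′) v0
    with ℕₚ.m≤n⇒∃[o]m+o≡n (ℕₚ.≤∧≢⇒< (a≤m a v0) (λ { refl → ℕₚ.0≢1+n (cong proj₂ (trans (sym vm) (va a v0))) }))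
  ... | m₁ , a+m₁≡m with trans (ℕₚ.+-comm m₁ (suc a)) a+m₁≡m
  ...   | refl with walk⇒trace fuel m₁ (ℕₚ.<-≤-trans (ℕₚ.m<m+n m₁ (s≤s z≤n)) m≤fuel) e′ (λ k → v (k + suc a))
                      (subst (_⟶ v (suc a)) (va a v0) (s a)) (λ k → s (k + suc a)) vm
                      (λ k≤ l≤ eq → ℕₚ.+-cancelʳ-≡ (suc a) _ _ (inj (ℕₚ.+-monoˡ-≤ (suc a) k≤) (ℕₚ.+-monoˡ-≤ (suc a) l≤) eq))
  ...     | traced P ok ab d tr = attach-or-jump (first v0)
    where
    new : All (λ x → e ≢ proj₂ x) P
    new = All.map (λ {x} → fresh {proj₂ x}) (∈-trace P)
      where
      fresh : ∀ {x} → (0 , x) ∈ trace e P → e ≢ x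
      -- A repeated distance `e` would bring the walk to `(0 , e)` a second time.
      fresh x∈ refl with ∈ₚ.∈-applyUpTo⁻ (λ k → v (k + suc a)) (subst ((0 , e) ∈_) (sym tr) x∈)
      ... | k , s≤s k≤m₁ , eq = ℕₚ.<⇒≢ (ℕₚ.m≤n+m (suc a) k)
              (inj (a≤m a v0) (ℕₚ.+-monoˡ-≤ (suc a) k≤m₁) (trans (va a v0) eq))
    whole : applyUpTo v (suc m) ≡ fall a e ++ trace e P
    whole = trans (applyUpTo-++ v (suc a) (suc m₁)) (cong₂ _++_ (applyUpTo-fall a v s v0) tr)
    attach-or-jump : p ≡ a ⊎ (0 < e × p ≡ a + e) → Traced (suc p) m v
    attach-or-jump (inj₁ refl) = traced ((false , e) ∷ P) (jump ok) (s≤s z≤n ∷ ab) (new ∷ d) whole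
    attach-or-jump (inj₂ (_ , refl)) = traced ((true , e) ∷ P) (attached (s≤s (ℕₚ.m≤n+m e a)) ok) (s≤s z≤n ∷ ab) (new ∷ d)
      (trans whole (cong (λ q → fall q e ++ trace e P) (sym (ℕₚ.m+n∸n≡m a e))))

-- An attached first entry is positive and would land strictly below `a`. So if `a` is the actual
-- landing height, the path opens with a block, as a start from {0,0} requires.
trace-head⇒Admissible₀ : ∀ {a P} → Admissible (suc a) P → Above 0 P → proj₁ (nth (trace (suc a) P) 0) ≡ a → Admissible 0 P
trace-head⇒Admissible₀ []        _  _ = []
trace-head⇒Admissible₀ (jump ok) _  _ = jump ok
trace-head⇒Admissible₀ {a} (attached {x = e} {P} (s≤s e≤a) ok) (e>0 ∷ _) eq =
  ⊥-elim (ℕₚ.<⇒≢ (ℕₚ.∸-monoʳ-< e>0 e≤a) (trans (sym (cong proj₁ (nth-fall (a ∸ e) (trace e P)))) eq))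

Admissible₀⇒trace-head : ∀ {a P} → Admissible 0 P → proj₁ (nth (trace (suc a) P) 0) ≡ a
Admissible₀⇒trace-head {a} []        = cong proj₁ (nth-fall′ a)
Admissible₀⇒trace-head {a} (jump ok) = cong proj₁ (nth-fall a _)

-- Patterns built from paths

module _ (n : ℕ) where

  -- The first landing height `n ∸ cost P` is the one that makes the total length `suc n`.
  cycle : Path → List Gap
  cycle P = trace (suc (n ∸ cost P)) P

  Valid : Path → Set
  Valid P = Good 0 P × cost P ≤ n

  weaken-Admissible : ∀ {p P} → Admissible 0 P → Admissible p P
  weaken-Admissible []        = []
  weaken-Admissible (jump ok) = jump ok

  length-cycle : ∀ {P} → Valid P → length (cycle P) ≡ suc n
  length-cycle {P} (good ok _ ab , c≤n) = trans (length-trace (s≤s z≤n) (weaken-Admissible ok) ab)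
                                            (cong suc (ℕₚ.m∸n+n≡m c≤n))

  cycle-chain : ∀ {P} → Valid P → Chain (0 , 0) (cycle P) (0 , 0)
  cycle-chain (good ok _ ab , _) = Chain-restart (Chain-trace (s≤s z≤n) (weaken-Admissible ok) ab)

  cycle-last : ∀ {P} → Valid P → nth (cycle P) n ≡ (0 , 0)
  cycle-last v = nth-last (cycle-chain v) (length-cycle v)

  cycle-injective : ∀ {P P′} → Valid P → Valid P′ → cycle P ≡ cycle P′ → P ≡ P′
  cycle-injective {P} {P′} (good ok _ ab , _) (good ok′ _ ab′ , _) eq =
    trace-injective (s≤s z≤n) (weaken-Admissible ok) (weaken-Admissible ok′) ab ab′
      (trans eq (cong (λ a → trace (suc a) P′) (sym same-start)))
    where
    same-start : n ∸ cost P ≡ n ∸ cost P′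
    same-start = trans (sym (Admissible₀⇒trace-head ok)) (trans (cong (λ w → proj₁ (nth w 0)) eq) (Admissible₀⇒trace-head ok′))

  at : Path → ℕ → Gap
  at P j = nth (cycle P) (j % suc n)

  at-< : ∀ P {j} → j < suc n → at P j ≡ nth (cycle P) j
  at-< P j<n = cong (nth (cycle P)) (m<n⇒m%n≡m j<n)

  at-injective : ∀ {P i j} → Valid P → i < suc n → j < suc n → at P i ≡ at P j → i ≡ j
  at-injective {P} v@(good _ d ab , _) i<n j<n eq =
    nth-injective (Unique-trace ab d) (subst (_ <_) (sym (length-cycle v)) i<n) (subst (_ <_) (sym (length-cycle v)) j<n)
      (trans (sym (at-< P i<n)) (trans eq (at-< P j<n)))

  at-step : ∀ {P} → Valid P → Walk (at P)
  at-step {P} v j with suc (j % suc n) ℕ.<? suc n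
  ... | yes lt = subst (λ i → at P j ⟶ nth (cycle P) i) (sym (trans suc-% (m<n⇒m%n≡m lt)))
                   (nth-⟶ (cycle-chain v) (subst (suc (j % suc n) <_) (sym (length-cycle v)) lt))
    where
    suc-% : suc j % suc n ≡ suc (j % suc n) % suc n
    suc-% = trans (cong (λ x → suc x % suc n) (m≡m%n+[m/n]*n j (suc n))) ([m+kn]%n≡m%n (suc (j % suc n)) (j ℕ./ suc n) (suc n))
  -- Here the cycle closes: position `n` holds `(0 , 0)`, which any state may follow.
  ... | no ¬lt = subst (_⟶ at P (suc j)) (sym (trans (cong (nth (cycle P)) end) (cycle-last v))) ⟶-restart
    where
    end : j % suc n ≡ n
    end = ℕₚ.suc-injective (ℕₚ.≤-antisym (m%n<n j (suc n)) (ℕₚ.≮⇒≥ ¬lt))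

  toPattern : ∀ {P} → Valid P → Pattern (suc n)
  toPattern {P} v = record
    { state    = λ j → toState (at P j)
    ; periodic = λ j i → cong (λ k → occ (nth (cycle P) k) i) ([m+n]%n≡m%n j (suc n))
    ; step     = λ j → _⟶_.occ-≤ (at-step v j)
    ; distinct = λ i j i<n j<n eq → at-injective v i<n j<n (occ-≤⇒≡ (at P i) (at P j) (λ k → ℕₚ.≤-reflexive (eq k)))
    }

  toPattern-strict : ∀ {P} (v : Valid P) → Strict (toPattern v)
  toPattern-strict {P} v = n , ℕₚ.≤-refl , 0 , cong (λ x → occ x 0) (trans (at-< P ℕₚ.≤-refl) (cycle-last v))

  -- Both cycles meet the state {0,0} only at time n, so the rotation is trivial.
  RotEq⇒≡ : ∀ {P P′} (v : Valid P) (v′ : Valid P′) → RotEq (toPattern v) (toPattern v′) → P ≡ P′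
  RotEq⇒≡ {P} {P′} v v′ (k , k<n , eq) = cycle-injective v v′
    (nth-ext (cycle P) (cycle P′) (trans (length-cycle v) (sym (length-cycle v′))) same)
    where
    at≡ : ∀ j → at P j ≡ at P′ (j + k)
    at≡ j = occ-≤⇒≡ (at P j) (at P′ (j + k)) (λ i → ℕₚ.≤-reflexive (eq j i))
    n≤n : n < suc n
    n≤n = ℕₚ.≤-refl
    back : (n + k) % suc n ≡ (n + 0) % suc n
    back = at-injective v′ (m%n<n (n + k) (suc n)) (m%n<n (n + 0) (suc n)) (begin
      at P′ ((n + k) % suc n) ≡⟨ cong (nth (cycle P′)) (m%n%n≡m%n (n + k) (suc n)) ⟩
      at P′ (n + k)           ≡⟨ at≡ n ⟨
      at P n                  ≡⟨ trans (at-< P n≤n) (cycle-last v) ⟩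
      0 , 0                   ≡⟨ trans (at-< P′ n≤n) (cycle-last v′) ⟨
      at P′ n                 ≡⟨ cong (at P′) (ℕₚ.+-identityʳ n) ⟨
      at P′ (n + 0)           ≡⟨ cong (nth (cycle P′)) (m%n%n≡m%n (n + 0) (suc n)) ⟨
      at P′ ((n + 0) % suc n) ∎)
    k≡0 : k ≡ 0
    k≡0 = %-cancelˡ n n k<n (s≤s z≤n) back
    same : ∀ i → i < length (cycle P) → nth (cycle P) i ≡ nth (cycle P′) i
    same i i<l = begin
      nth (cycle P) i  ≡⟨ at-< P i<n ⟨
      at P i           ≡⟨ at≡ i ⟩
      at P′ (i + k)    ≡⟨ cong (at P′) (trans (cong (i ℕ.+_) k≡0) (ℕₚ.+-identityʳ i)) ⟩
      at P′ i          ≡⟨ at-< P′ i<n ⟩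
      nth (cycle P′) i ∎
      where i<n = subst (i <_) (length-cycle v) i<l

  occ≡2⇒ : ∀ x {i} → occ x i ≡ 2 → x ≡ (i , 0)
  occ≡2⇒ (a , d) {i} eq = cong₂ _,_ a≡i (ℕₚ.+-cancelˡ-≡ a d 0 (trans a+d≡i (trans (sym a≡i) (sym (ℕₚ.+-identityʳ a)))))
    where
    a≡i : a ≡ i
    a≡i = 1≤δ⇒≡ (ℕₚ.+-cancelʳ-≤ 1 1 (δ a i) (subst (_≤ δ a i + 1) eq (ℕₚ.+-monoʳ-≤ (δ a i) (δ≤1 (a + d) i))))
    a+d≡i : a + d ≡ i
    a+d≡i = 1≤δ⇒≡ (ℕₚ.+-cancelˡ-≤ 1 1 (δ (a + d) i) (subst (_≤ 1 + δ (a + d) i) eq (ℕₚ.+-monoˡ-≤ (δ (a + d) i) (δ≤1 a i))))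

  -- Every strict pattern is a rotation of one built from a path

  module Complete (p : Pattern (suc n)) where

    s : ℕ → Gap
    s j = proj₁ (decode (state p j))

    α≡ : ∀ j i → α (state p j) i ≡ occ (s j) i
    α≡ j = proj₂ (decode (state p j))

    s-step : Walk s
    s-step j = arrow λ i → subst₂ _≤_ (α≡ j (suc i)) (α≡ (suc j) i) (step p j i)

    s-periodic : ∀ j → s (j + suc n) ≡ s j
    s-periodic j = occ-≤⇒≡ (s (j + suc n)) (s j) (λ i → ℕₚ.≤-reflexive (trans (sym (α≡ _ i)) (trans (periodic p j i) (α≡ j i))))

    s-injective : ∀ {i j} → s i ≡ s j → i % suc n ≡ j % suc n
    s-injective {i} {j} eq = distinct p _ _ (m%n<n i (suc n)) (m%n<n j (suc n)) (λ l → begin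
      α (state p (i % suc n)) l ≡⟨ α≡ _ l ⟩
      occ (s (i % suc n)) l     ≡⟨ cong (λ x → occ x l) (trans (periodic-% s (suc n) s-periodic i) (trans eq (sym (periodic-% s (suc n) s-periodic j)))) ⟩
      occ (s (j % suc n)) l     ≡⟨ α≡ _ l ⟨
      α (state p (j % suc n)) l ∎)

    -- With period `suc n`, time `K + n` is the beat before `K`, one period later. So `u` starts
    -- right after a visit to `(0 , 0)` and returns there at time `n`.
    module From (K : ℕ) (start : s (K + n) ≡ (0 , 0)) where

      u : ℕ → Gap
      u k = s (K + k)

      u-step : Walk u
      u-step k = subst (λ l → u k ⟶ s l) (sym (ℕₚ.+-suc K k)) (s-step (K + k))

      a = proj₁ (u 0)

      tr : Traced (suc a) n u
      -- The true predecessor `(0 , 0)` is replaced by `(0 , suc a)`, which can also be followed by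
      -- `u 0`.
      tr = walk⇒trace (suc n) n ℕₚ.≤-refl a u ⟶-over u-step start
             (λ k≤ l≤ eq → %-cancelˡ n K (s≤s k≤) (s≤s l≤) (s-injective eq))

      open Traced tr renaming (distinct to gaps-distinct)

      total : suc n ≡ suc a + cost path
      total = trans (sym (Listₚ.length-applyUpTo u (suc n))) (trans (cong length trace≡) (length-trace (s≤s z≤n) ok above))

      valid : Valid path
      valid = good (trace-head⇒Admissible₀ ok above (cong (λ w → proj₁ (nth w 0)) (sym trace≡))) gaps-distinct above
            , subst (cost path ≤_) (sym (ℕₚ.suc-injective total)) (ℕₚ.m≤n+m (cost path) a)

      cycle≡ : cycle path ≡ applyUpTo u (suc n)
      cycle≡ = trans (cong (λ q → trace (suc q) path)
        (trans (cong (_∸ cost path) (ℕₚ.suc-injective total)) (ℕₚ.m+n∸n≡m a (cost path)))) (sym trace≡)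

      -- This is -K modulo `suc n`, because `K + K * n` is a multiple of `suc n`.
      r = K ℕ.* n % suc n

      at≡s : ∀ j → at path (j + r) ≡ s j
      at≡s j = begin
        nth (cycle path) ((j + r) % suc n)          ≡⟨ cong (λ w → nth w ((j + r) % suc n)) cycle≡ ⟩
        nth (applyUpTo u (suc n)) ((j + r) % suc n) ≡⟨ nth-applyUpTo u (m%n<n (j + r) (suc n)) ⟩
        u ((j + r) % suc n)                         ≡⟨ periodic-% u (suc n) (shifted K) (j + r) ⟩
        s (K + (j + r))                             ≡⟨ cong s (ℕₚ.+-assoc K j r) ⟨
        s (K + j + r)                               ≡⟨ periodic-% (λ k → s (K + j + k)) (suc n) (shifted (K + j)) (K ℕ.* n) ⟩
        s (K + j + K ℕ.* n)                         ≡⟨ cong s (trans (cong (_+ K ℕ.* n) (ℕₚ.+-comm K j)) (ℕₚ.+-assoc j K _)) ⟩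
        s (j + (K + K ℕ.* n))                       ≡⟨ cong (λ x → s (j + x)) (ℕₚ.*-suc K n) ⟨
        s (j + K ℕ.* suc n)                         ≡⟨ periodic-* s (suc n) s-periodic j K ⟩
        s j                                         ∎
        where
        shifted : ∀ l k → s (l + (k + suc n)) ≡ s (l + k)
        shifted l k = trans (cong s (sym (ℕₚ.+-assoc l k (suc n)))) (s-periodic (l + k))

      rotated : (v : Valid path) → RotEq p (toPattern v)
      rotated v = r , m%n<n (K ℕ.* n) (suc n) , λ j i → trans (α≡ j i) (cong (λ x → occ x i) (sym (at≡s j)))

  strict⇒rotated : (p : Pattern (suc n)) → Strict p → ∃ λ P → Valid P × ((v : Valid P) → RotEq p (toPattern v))
  strict⇒rotated p (j , _ , i , eq) = F.path , F.valid , F.rotated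
    where
    open Complete p
    fallen : s (i + j) ≡ (0 , 0)
    fallen = land i (λ k → s (k + j)) (λ k → s-step (k + j)) (occ≡2⇒ (s j) (trans (sym (α≡ j i)) eq))
    start : s (suc (i + j) + n) ≡ (0 , 0)
    start = trans (cong s (sym (ℕₚ.+-suc (i + j) n))) (trans (s-periodic (i + j)) fallen)
    module F where
      open From (suc (i + j)) start public
      open Traced tr public using (path)

  patterns : ∀ {Ps} → All Valid Ps → List (Pattern (suc n))
  patterns = All.reduce toPattern

  All-strict : ∀ {Ps} (vs : All Valid Ps) → All Strict (patterns vs)
  All-strict []       = []
  All-strict (v ∷ vs) = toPattern-strict v ∷ All-strict vs

  patterns-distinct : ∀ {Ps} (vs : All Valid Ps) → Unique Ps → AllPairs (λ p q → ¬ RotEq p q) (patterns vs)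
  patterns-distinct []       []       = []
  patterns-distinct (v ∷ vs) (n ∷ u) = each vs n ∷ patterns-distinct vs u
    where
    each : ∀ {Ps} (vs : All Valid Ps) → All (_ ≢_) Ps → All (λ q → ¬ RotEq (toPattern v) q) (patterns vs)
    each []        []       = []
    each (v′ ∷ vs) (n ∷ ns) = (λ rot → n (RotEq⇒≡ v v′ rot)) ∷ each vs ns

  ∈-patterns : ∀ {Ps P} {R : Pattern (suc n) → Set} (vs : All Valid Ps) → P ∈ Ps →
               ((v : Valid P) → R (toPattern v)) → Any R (patterns vs)
  ∈-patterns (v ∷ vs) (here refl) r = here (r v)
  ∈-patterns (v ∷ vs) (there P∈)  r = there (∈-patterns vs P∈ r)

  length-patterns : ∀ {Ps} (vs : All Valid Ps) → length (patterns vs) ≡ length Ps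
  length-patterns []       = refl
  length-patterns (v ∷ vs) = cong suc (length-patterns vs)

-- The complete list of paths and its length

good-[] : ∀ {b} → Good b []
good-[] = good [] [] []

-- An entry is at most its block maximum, which is a summand of the cost, or lies below `p` if it
-- continues the block of `p`.
bounded : ∀ {p P} → Admissible p P → All (λ e → proj₂ e ≤ p + cost P) P
bounded [] = []
bounded {p} (attached {x = x} {P} x<p ok) =
  ℕₚ.≤-trans (ℕₚ.<⇒≤ x<p) (ℕₚ.m≤m+n p (cost P)) ∷
  All.map (λ le → ℕₚ.≤-trans le (ℕₚ.+-monoˡ-≤ (cost P) (ℕₚ.<⇒≤ x<p))) (bounded ok)
bounded {p} (jump {x = x} {P} ok) =
  ℕₚ.≤-trans (ℕₚ.m≤m+n x (cost P)) (ℕₚ.m≤n+m _ p) ∷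
  All.map (λ le → ℕₚ.≤-trans le (ℕₚ.m≤n+m _ p)) (bounded ok)

-- By `bounded`, a path of cost `m` has no value above `m`, so placing starts there. The bound
-- `m ≤ n` leaves at least one of the `suc n` beats for the first step.
paths : ℕ → List Path
paths n = concatMap (λ m → extensions m [] m) (upTo (suc n))

paths-valid : ∀ n → All (Valid n) (paths n)
paths-valid n = All.tabulate valid
  where
  valid : ∀ {P} → P ∈ paths n → Valid n P
  valid P∈ with ∈-concatMap⁻′ (λ m → extensions m [] m) (upTo (suc n)) P∈
  ... | m , m∈ , P∈m with extensions⁻ m m good-[] P∈m
  ...   | extends g c≡ _ = g , subst (_≤ n) (sym c≡) (ℕₚ.≤-pred (∈ₚ.∈-upTo⁻ m∈))

paths-unique : ∀ n → Unique (paths n)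
paths-unique n = Unique-concatMap (λ m → extensions m [] m) cost (Uniqueₚ.upTo⁺ (suc n))
  (λ {m} _ → Unique-extensions m m good-[])
  (λ {m} _ P∈ → Extends.cost≡ (extensions⁻ m m good-[] P∈))

valid⇒∈-paths : ∀ n {P} → Valid n P → P ∈ paths n
valid⇒∈-paths n {P} (g , c≤n) = ∈-concatMap⁺′ (λ m → extensions m [] m) (∈ₚ.∈-upTo⁺ (s≤s c≤n))
  (subst (λ S → P ∈ extensions (cost P) S (cost P)) empty
    (extensions⁺ (cost P) (cost P) g (cong (λ S → cost S + cost P) (sym empty))))
  where
  empty : keep (cost P) P ≡ []
  empty = Listₚ.filter-none _ (All.map ℕₚ.≤⇒≯ (bounded (Good.ok g)))

length-paths : ∀ n → length (paths n) ≡ sum (map (λ m → placements m 0 m) (upTo (suc n)))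
length-paths n = go (upTo (suc n))
  where
  go : ∀ ms → length (concatMap (λ m → extensions m [] m) ms) ≡ sum (map (λ m → placements m 0 m) ms)
  go []       = refl
  go (m ∷ ms) = trans (Listₚ.length-++ (extensions m [] m)) (cong₂ _+_ (length-extensions m m good-[]) (go ms))

theorem3p3 : (n : ℕ) → 1 ≤ n →
    Σ ℕ λ k → StrictCount n k × ((+ k) / 1 ≡ rhs n)
theorem3p3 (suc n) _ = length (paths n) ,
  ( patterns n vs
  , All-strict n vs
  , patterns-distinct n vs (paths-unique n)
  , (λ p strict → let P , v , rot = strict⇒rotated n p strict in ∈-patterns n vs (valid⇒∈-paths n v) rot)
  , length-patterns n vs )
  , trans (cong fromℕ (length-paths n)) (rhs≡∑placements n)
  where vs = paths-valid n
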